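{- Let $N=(G=(V,E),\sigma,u,s)$ be a skew-symmetric network in which no arc enters $s$. Then every maximum IS-flow in $N$ is an optimal solution of the linear program: maximize $\sum_{a\text{ leaving }s}f(a)$ over $f\in\mathbb R^E$ subject to $0\le f(a)\le u(a)$ for all $a\in E$; $\sum_{a\text{ leaving }v}f(a)-\sum_{a\text{ entering }v}f(a)=0$ for all $v\in V\setminus\{s,s'\}$; and $\sum_{a\in E}f(a)\chi_\rho(a)\le 2u(U_\rho)-2$ for every odd fragment $\rho=(V_\rho,U_\rho)$. (In particular, this LP has no symmetry or integrality constraints, and its optimum value equals the maximum IS-flow value.)
   Context: A skew-symmetric graph is a finite directed graph $G=(V,E)$ (parallel arcs allowed) with a map $\sigma$ of $V\cup E$ onto itself such that $\sigma(x)\ne x$, $\sigma(\sigma(x))=x$ for all $x$, $\sigma(V)=V$, and for each arc $a$ from $v$ to $w$, $\sigma(a)$ is an arc from $\sigma(w)$ to $\sigma(v)$. A function on $E$ is symmetric if it takes equal values on $a$ and $\sigma(a)$. A skew-symmetric network is $N=(G,\sigma,u,s)$ with $u:E\to\mathbb Z_{\ge0}$ symmetric and source $s$; $s'=\sigma(s)$. A flow is $f:E\to\mathbb R_{\ge0}$ with $f\le u$ and conservation at nodes other than $s,s'$; an IS-flow is an integer-valued symmetric flow, and a maximum IS-flow is one of maximum value (net outflow at $s$). For $S\subseteq E$, $u(S)=\sum_{a\in S}u(a)$. An odd fragment is a pair $\rho=(V_\rho,U_\rho)$ where $V_\rho\subseteq V$ is self-symmetric ($\sigma(V_\rho)=V_\rho$),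 $s\notin V_\rho$, and $U_\rho$ is a set of arcs entering $V_\rho$ with $u(U_\rho)$ odd. Its characteristic function $\chi_\rho:E\to\{ -1,0,1\}$ is $\chi_\rho(a)=1$ if $a\in U_\rho\cup\sigma(U_\rho)$, $\chi_\rho(a)=-1$ if $a\in\delta(V_\rho)\setminus(U_\rho\cup\sigma(U_\rho))$, and $0$ otherwise, where $\delta(V_\rho)$ is the set of arcs with exactly one end in $V_\rho$. -}

module Defs where

open import Algebra.Bundles using (CommutativeMonoid)
open import Algebra.Bundles.Raw using (RawMonoid)
import Algebra.Definitions.RawMonoid as RawMonoidDefs
import Algebra.Properties.CommutativeSemigroup as CommutativeSemigroupProperties
open import Data.Bool.Base using (if_then_else_; _xor_)
open import Data.Fin.Base using (Fin)
open import Data.Fin.Properties using (_≟_)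
open import Data.Fin.Subset using (Subset; _∈_; _∉_; _∪_)
open import Data.Fin.Subset.Properties using (_∈?_)
open import Data.Integer.Base as ℤ using (ℤ; +_; -[1+_]; 0ℤ; 1ℤ; -1ℤ)
open import Data.Nat.Base as ℕ using (ℕ)
import Data.Nat.Properties as ℕ
open import Data.Nat.Divisibility using (_∣_)
open import Data.Product.Base using (∃-syntax; _×_; _,_)
open import Data.Rational.Base as ℚ using (ℚ; 0ℚ; ½; ∣_∣; _/_)
import Data.Rational.Properties as ℚ
open import Data.Vec.Base using (lookup; tabulate)
open import Level using (0ℓ)
open import Relation.Binary.PropositionalEquality
  using (_≡_; _≢_; refl; sym; trans; cong; subst)
open import Relation.Nullary using (¬_; does)

------------------------------------------------------------------------
-- Real numbers: Cauchy sequences of rationals, with a setoid equality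

IsCauchy : (ℕ → ℚ) → Set
IsCauchy x = ∀ ε → 0ℚ ℚ.< ε →
  ∃[ N ] (∀ m n → N ℕ.≤ m → N ℕ.≤ n → ∣ x m ℚ.- x n ∣ ℚ.< ε)

record ℝ : Set where
  constructor mkℝ
  field
    seq    : ℕ → ℚ
    cauchy : IsCauchy seq

open ℝ public

infix  4 _≃_ _≤ℝ_
infixl 6 _+ℝ_ _-ℝ_
infix  8 -ℝ_
infixr 8 _·_

_≃_ : ℝ → ℝ → Set
x ≃ y = ∀ ε → 0ℚ ℚ.< ε →
  ∃[ N ] (∀ n → N ℕ.≤ n → ∣ seq x n ℚ.- seq y n ∣ ℚ.< ε)

_≤ℝ_ : ℝ → ℝ → Set
x ≤ℝ y = ∀ ε → 0ℚ ℚ.< ε →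
  ∃[ N ] (∀ n → N ℕ.≤ n → seq x n ℚ.< seq y n ℚ.+ ε)

fromℚ : ℚ → ℝ
fromℚ q = mkℝ (λ _ → q) λ ε 0<ε → 0 , λ _ _ _ _ →
  subst (ℚ._< ε) (sym (cong ∣_∣ (ℚ.+-inverseʳ q))) 0<ε

fromℤ : ℤ → ℝ
fromℤ z = fromℚ (z / 1)

0ℝ : ℝ
0ℝ = fromℚ 0ℚ

private
  0<½*ε : ∀ ε → 0ℚ ℚ.< ε → 0ℚ ℚ.< ½ ℚ.* ε
  0<½*ε ε 0<ε = subst (ℚ._< ½ ℚ.* ε) (ℚ.*-zeroʳ ½) (ℚ.*-monoʳ-<-pos ½ 0<ε)

  ½*ε+½*ε≡ε : ∀ ε → ½ ℚ.* ε ℚ.+ ½ ℚ.* ε ≡ ε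
  ½*ε+½*ε≡ε ε = trans (sym (ℚ.*-distribʳ-+ ε ½ ½)) (ℚ.*-identityˡ ε)

  interchange : ∀ a b c d →
    (a ℚ.+ b) ℚ.- (c ℚ.+ d) ≡ (a ℚ.- c) ℚ.+ (b ℚ.- d)
  interchange a b c d = trans
    (cong (a ℚ.+ b ℚ.+_) (ℚ.neg-distrib-+ c d))
    (medial a b (ℚ.- c) (ℚ.- d))
    where open CommutativeSemigroupProperties
                 (CommutativeMonoid.commutativeSemigroup ℚ.+-0-commutativeMonoid)
                 renaming (interchange to medial)

  ∣+∣< : ∀ a b c d {δ η} → ∣ a ℚ.- c ∣ ℚ.< δ → ∣ b ℚ.- d ∣ ℚ.< η →
    ∣ (a ℚ.+ b) ℚ.- (c ℚ.+ d) ∣ ℚ.< δ ℚ.+ η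
  ∣+∣< a b c d {δ} {η} p q =
    subst (λ t → ∣ t ∣ ℚ.< δ ℚ.+ η) (sym (interchange a b c d))
      (ℚ.≤-<-trans (ℚ.∣p+q∣≤∣p∣+∣q∣ (a ℚ.- c) (b ℚ.- d)) (ℚ.+-mono-< p q))

  +-cauchy : ∀ x y → IsCauchy x → IsCauchy y → IsCauchy (λ n → x n ℚ.+ y n)
  +-cauchy x y cx cy ε 0<ε
    with cx (½ ℚ.* ε) (0<½*ε ε 0<ε) | cy (½ ℚ.* ε) (0<½*ε ε 0<ε)
  ... | M , p | N , q = M ℕ.⊔ N , λ m n m≥ n≥ →
    subst (∣ (x m ℚ.+ y m) ℚ.- (x n ℚ.+ y n) ∣ ℚ.<_) (½*ε+½*ε≡ε ε)
      (∣+∣< (x m) (y m) (x n) (y n)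
        (p m n (ℕ.m⊔n≤o⇒m≤o M N m≥) (ℕ.m⊔n≤o⇒m≤o M N n≥))
        (q m n (ℕ.m⊔n≤o⇒n≤o M N m≥) (ℕ.m⊔n≤o⇒n≤o M N n≥)))

  neg-cauchy : ∀ x → IsCauchy x → IsCauchy (λ n → ℚ.- x n)
  neg-cauchy x cx ε 0<ε with cx ε 0<ε
  ... | N , p = N , λ m n m≥ n≥ → subst (ℚ._< ε)
    (sym (trans
      (cong ∣_∣ (sym (ℚ.neg-distrib-+ (x m) (ℚ.- x n))))
      (ℚ.∣-p∣≡∣p∣ (x m ℚ.- x n))))
    (p m n m≥ n≥)

_+ℝ_ : ℝ → ℝ → ℝ
x +ℝ y = mkℝ (λ n → seq x n ℚ.+ seq y n) (+-cauchy (seq x) (seq y) (cauchy x) (cauchy y))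

-ℝ_ : ℝ → ℝ
-ℝ x = mkℝ (λ n → ℚ.- seq x n) (neg-cauchy (seq x) (cauchy x))

_-ℝ_ : ℝ → ℝ → ℝ
x -ℝ y = x +ℝ (-ℝ y)

+ℝ-rawMonoid : RawMonoid 0ℓ 0ℓ
+ℝ-rawMonoid = record { Carrier = ℝ ; _≈_ = _≃_ ; _∙_ = _+ℝ_ ; ε = 0ℝ }

open RawMonoidDefs +ℝ-rawMonoid using () renaming (_×_ to _×ℝ_; sum to sumℝ)
open RawMonoidDefs ℕ.+-0-rawMonoid using () renaming (sum to sumℕ)

-- The only products in the linear program have an integer factor.
_·_ : ℤ → ℝ → ℝ
(+ n)    · x = n ×ℝ x
-[1+ n ] · x = -ℝ (ℕ.suc n ×ℝ x)

------------------------------------------------------------------------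
-- Finite sums

module _ {m : ℕ} where

  Σℝ : (Fin m → ℝ) → ℝ
  Σℝ = sumℝ

  Σℝ[_] : Subset m → (Fin m → ℝ) → ℝ
  Σℝ[ S ] f = sumℝ λ a → if does (a ∈? S) then f a else 0ℝ

  Σℕ[_] : Subset m → (Fin m → ℕ) → ℕ
  Σℕ[ S ] u = sumℕ λ a → if does (a ∈? S) then u a else 0

------------------------------------------------------------------------
-- Skew-symmetric networks with n nodes and m arcs

-- The involution of V ∪ E preserves V, hence also E; it is given by its
-- restrictions σV and σE. Being involutions, both are onto.
record SkewSymmetricGraph (n m : ℕ) : Set where
  field
    tail head     : Fin m → Fin n
    σV            : Fin n → Fin n
    σE            : Fin m → Fin m
    σV-noFixed    : ∀ v → σV v ≢ v
    σE-noFixed    : ∀ a → σE a ≢ a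
    σV-involutive : ∀ v → σV (σV v) ≡ v
    σE-involutive : ∀ a → σE (σE a) ≡ a
    tail-σE       : ∀ a → tail (σE a) ≡ σV (head a)
    head-σE       : ∀ a → head (σE a) ≡ σV (tail a)

  leaving entering : Fin n → Subset m
  leaving  v = tabulate λ a → does (tail a ≟ v)
  entering v = tabulate λ a → does (head a ≟ v)

  δ : Subset n → Subset m
  δ X = tabulate λ a → lookup X (tail a) xor lookup X (head a)

  -- Images under σ; an image is the preimage since σ is an involution.
  σ[_]V : Subset n → Subset n
  σ[ X ]V = tabulate λ v → lookup X (σV v)

  σ[_]E : Subset m → Subset m
  σ[ S ]E = tabulate λ a → lookup S (σE a)

record SkewSymmetricNetwork (n m : ℕ) : Set where
  field
    graph : SkewSymmetricGraph n m
  open SkewSymmetricGraph graph public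
  field
    u           : Fin m → ℕ
    u-symmetric : ∀ a → u (σE a) ≡ u a
    s           : Fin n

  s′ : Fin n
  s′ = σV s

module _ {n m : ℕ} (N : SkewSymmetricNetwork n m) where

  open SkewSymmetricNetwork N

  NoArcEntersSource : Set
  NoArcEntersSource = ∀ a → head a ≢ s

  netOutflow : (Fin m → ℝ) → Fin n → ℝ
  netOutflow f v = Σℝ[ leaving v ] f -ℝ Σℝ[ entering v ] f

  value : (Fin m → ℝ) → ℝ
  value f = netOutflow f s

  record IsFlow (f : Fin m → ℝ) : Set where
    field
      nonNegative  : ∀ a → 0ℝ ≤ℝ f a
      capacity     : ∀ a → f a ≤ℝ fromℤ (+ u a)
      conservation : ∀ v → v ≢ s → v ≢ s′ → netOutflow f v ≃ 0ℝ

  record IsISFlow (f : Fin m → ℝ) : Set where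
    field
      isFlow    : IsFlow f
      integral  : ∀ a → ∃[ z ] f a ≃ fromℤ z
      symmetric : ∀ a → f (σE a) ≃ f a

  IsMaximumISFlow : (Fin m → ℝ) → Set
  IsMaximumISFlow f = IsISFlow f × (∀ g → IsISFlow g → value g ≤ℝ value f)

  record OddFragment : Set where
    field
      nodes         : Subset n
      arcs          : Subset m
      selfSymmetric : σ[ nodes ]V ≡ nodes
      source∉       : s ∉ nodes
      arcsEnter     : ∀ a → a ∈ arcs → tail a ∉ nodes × head a ∈ nodes
      odd           : ¬ (2 ∣ Σℕ[ arcs ] u)

  χ : OddFragment → Fin m → ℤ
  χ ρ a =
    if does (a ∈? (arcs ∪ σ[ arcs ]E)) then 1ℤ
    else if does (a ∈? δ nodes) then -1ℤ
    else 0ℤ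
    where open OddFragment ρ

  objective : (Fin m → ℝ) → ℝ
  objective f = Σℝ[ leaving s ] f

  record IsFeasible (f : Fin m → ℝ) : Set where
    field
      nonNegative  : ∀ a → 0ℝ ≤ℝ f a
      capacity     : ∀ a → f a ≤ℝ fromℤ (+ u a)
      conservation : ∀ v → v ≢ s → v ≢ s′ →
        Σℝ[ leaving v ] f -ℝ Σℝ[ entering v ] f ≃ 0ℝ
      oddFragment  : ∀ (ρ : OddFragment) →
        Σℝ (λ a → χ ρ a · f a)
          ≤ℝ fromℤ (+ 2 ℤ.* + Σℕ[ OddFragment.arcs ρ ] u ℤ.- + 2)

  IsOptimalSolution : (Fin m → ℝ) → Set
  IsOptimalSolution f =
    IsFeasible f × (∀ g → IsFeasible g → objective g ≤ℝ objective f)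

  IsOptimumValue : ℝ → Set
  IsOptimumValue r = ∃[ g ] (IsOptimalSolution g × objective g ≃ r)

{-# OPTIONS --safe #-}

-- The fragment constraints hold for an integer symmetric flow F by parity: F carries an
-- even amount into a self-symmetric node set that avoids the source, so an odd set of
-- entering arcs leaves slack at least one.
--
-- For optimality, consider the residual arcs of F and call a trail from s regular if it
-- uses no residual arc twice and none together with its mate. If F is maximum, σ s is not
-- reachable by a regular trail, since pushing flow along such a trail and along its mate
-- would increase the value by two. Let A be the set of nodes v such that v is reachable
-- and σ v is not. An entry is a residual arc from A to a node that is reachable together
-- with its mate. Nodes of the latter kind that are dominated by the same entries as the
-- head of some entry form a self-symmetric component; exactly one residual arc leads to
-- it from A, and none from elsewhere outside σ A. Hence its fragment constraint is tight
-- for F, and potentials 2 on A, 0 on σ A and 1 elsewhere, together with multipliers 1 for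
-- these constraints, satisfy complementary slackness with F. The argument is classical;
-- it is carried out under a double negation, which the order of the reals absorbs.

module Submission where

open import Defs
open import Algebra.Bundles using (CommutativeRing)
import Algebra.Definitions.RawMonoid as RawMonoidSum
import Algebra.Properties.Ring as RingProperties
import Algebra.Properties.Semiring.Sum as SemiringSum
open import Data.Bool.Base using (Bool; true; false; if_then_else_; _∧_; _∨_; _xor_)
import Data.Bool.Properties as Bool
open import Data.Empty using (⊥; ⊥-elim)
open import Data.Fin.Base as Fin using (Fin; zero; suc)
open import Data.Fin.Permutation using (permutation)
open import Data.Fin.Properties as Fin using (_≟_; sequence; any?)
open import Data.Fin.Subset using (Subset; _∪_)
  renaming (_∈_ to _∈ₛ_; _∉_ to _∉ₛ_)
open import Data.Fin.Subset.Properties using (_∈?_)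
open import Data.Integer.Base as ℤ using (ℤ; +_; -[1+_]; 0ℤ; 1ℤ; -1ℤ)
import Data.Integer.Properties as ℤ
import Data.Integer.Tactic.RingSolver as ℤ-Solver
open import Data.List.Base using (List; []; _∷_; _++_; [_])
open import Data.List.Membership.Propositional using (_∈_; _∉_; find; lose)
open import Data.List.Membership.Propositional.Properties
  using (∈-++⁺ˡ; ∈-++⁺ʳ; ∈-++⁻; ∈-∃++)
open import Data.List.Properties using (++-assoc)
open import Data.List.Relation.Unary.All as All using ([]; _∷_)
open import Data.List.Relation.Unary.AllPairs using (AllPairs; []; _∷_)
import Data.List.Relation.Unary.AllPairs.Properties as AllPairs
open import Data.List.Relation.Unary.Any as Any using (here; there)
open import Data.Nat.Base as ℕ using (ℕ; zero; suc)
open import Data.Nat.Divisibility using (_∣_; divides)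
import Data.Nat.Properties as ℕ
open import Data.Product.Base using (∃-syntax; ∃; _×_; _,_; proj₁; proj₂)
open import Data.Product.Properties using (≡-dec)
open import Data.Rational.Base as ℚ using (ℚ; 0ℚ; 1ℚ; ½; ∣_∣; _/_; toℚᵘ)
import Data.Rational.Properties as ℚ
open import Data.Rational.Solver using (module +-*-Solver)
open import Data.Rational.Unnormalised.Base as ℚᵘ using (mkℚᵘ; *≤*)
import Data.Rational.Unnormalised.Properties as ℚᵘ
open import Data.Sum.Base using (_⊎_; inj₁; inj₂)
open import Data.Vec.Base using (lookup; tabulate; _∷_)
open import Data.Vec.Properties
  using (lookup∘tabulate; lookup-zipWith; lookup⇒[]=; []=⇒lookup; tabulate-cong)
open import Effect.Monad using (RawMonad)
open import Function.Base using (_∘_)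
open import Function.Bundles using (mk⇔)
open import Level using (0ℓ)
open import Relation.Binary.Bundles using (Preorder)
open import Relation.Binary.Definitions using (DecidableEquality; tri<; tri≈; tri>)
open import Relation.Binary.PropositionalEquality as ≡
  using (_≡_; _≢_; refl; sym; trans; cong; cong₂; subst; subst₂)
open import Relation.Nullary using (¬_; Dec; yes; no; does)
open import Relation.Nullary.Decidable
  using (_⊎-dec_; dec-true; dec-false; does-⇔; ¬¬-excluded-middle)
open import Relation.Nullary.Negation using (¬¬-Monad; ¬¬-map)

-- Sums and net flows

-- Regular trails cannot be concatenated freely, since two of them may share an arc or contain
-- mates. So reachability does not simply propagate along residual arcs, and a cut alone does not
-- certify optimality; this is where the fragments come in. No blossoms are shrunk: the components
-- are read off the regular trails by domination, and the trail arguments cut one trail at its first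
-- clash with another. The pivot is that an entry dominates `z` exactly when it dominates `σ z`, for
-- inner `z`; this makes the components self-symmetric.
--
-- The potentials are doubled to stay integral, so the certificate bounds twice the objective.
-- Potentials of `v` and `σ v` add up to 2, and the fragment constraints weigh an arc and its mate
-- equally. The resulting dual solution is valid for the program without symmetry constraints.
--
-- Reachability and domination quantify over lists of arcs and are never decided. Each node is
-- classified under a double negation.

module NetFlow (R : CommutativeRing 0ℓ 0ℓ) where
  open CommutativeRing R hiding (zero) renaming (refl to ≈-refl; sym to ≈-sym; trans to ≈-trans)
  open SemiringSum semiring public
  open RingProperties ring using (-1*x≈-x; x[y-z]≈xy-xz; [y-z]x≈yx-zx)
  open import Relation.Binary.Reasoning.Setoid setoid

  ⟦_⟧ : Bool → Carrier
  ⟦ b ⟧ = if b then 1# else 0#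

  sum-select : ∀ {k} (x : Fin k) (g : Fin k → Carrier) → sum (λ v → ⟦ does (x ≟ v) ⟧ * g v) ≈ g x
  sum-select {suc k} zero g = begin
    1# * g zero + sum (λ v → 0# * g (suc v))   ≈⟨ +-cong (*-identityˡ _) (sum-cong-≋ {k} λ v → zeroˡ (g (suc v))) ⟩
    g zero + sum {k} (λ _ → 0#)                 ≈⟨ +-congˡ (sum-replicate-zero k) ⟩
    g zero + 0#                                ≈⟨ +-identityʳ _ ⟩
    g zero                                     ∎
  sum-select (suc x) g = begin
    0# * g zero + sum (λ v → ⟦ does (x ≟ v) ⟧ * g (suc v)) ≈⟨ +-cong (zeroˡ _) (sum-select x (g ∘ suc)) ⟩
    0# + g (suc x)                                         ≈⟨ +-identityˡ _ ⟩
    g (suc x)                                              ∎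

  sum-neg : ∀ {k} (f : Fin k → Carrier) → sum (λ a → - f a) ≈ - sum f
  sum-neg f = begin
    sum (λ a → - f a)           ≈⟨ sum-cong-≋ (λ a → ≈-sym (-1*x≈-x (f a))) ⟩
    sum (λ a → (- 1#) * f a)    ≈⟨ *-distribˡ-sum (- 1#) f ⟨
    (- 1#) * sum f              ≈⟨ -1*x≈-x (sum f) ⟩
    - sum f                     ∎

  sum-distrib-- : ∀ {k} (f g : Fin k → Carrier) → sum (λ a → f a - g a) ≈ sum f - sum g
  sum-distrib-- f g = ≈-trans (∑-distrib-+ f (λ a → - g a)) (+-congˡ (sum-neg g))

  module _ {n m : ℕ} (tail head : Fin m → Fin n) where

    net : (Fin m → Carrier) → Fin n → Carrier
    net f v = sum (λ a → ⟦ does (tail a ≟ v) ⟧ * f a) - sum (λ a → ⟦ does (head a ≟ v) ⟧ * f a)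

    sum-incident : ∀ (end : Fin m → Fin n) (k : Fin n → Carrier) (f : Fin m → Carrier) →
      sum (λ v → k v * sum (λ a → ⟦ does (end a ≟ v) ⟧ * f a)) ≈ sum (λ a → k (end a) * f a)
    sum-incident end k f = begin
      sum (λ v → k v * sum (λ a → ⟦ does (end a ≟ v) ⟧ * f a))
        ≈⟨ sum-cong-≋ (λ v → *-distribˡ-sum (k v) (λ a → ⟦ does (end a ≟ v) ⟧ * f a)) ⟩
      sum (λ v → sum (λ a → k v * (⟦ does (end a ≟ v) ⟧ * f a)))
        ≈⟨ ∑-comm (λ v a → k v * (⟦ does (end a ≟ v) ⟧ * f a)) ⟩
      sum (λ a → sum (λ v → k v * (⟦ does (end a ≟ v) ⟧ * f a)))
        ≈⟨ sum-cong-≋ (λ a → ≈-trans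
             (sum-cong-≋ {n} λ v → ≈-trans (≈-sym (*-assoc (k v) _ (f a)))
               (≈-trans (*-congʳ (*-comm (k v) _)) (*-assoc _ (k v) (f a))))
             (sum-select (end a) (λ v → k v * f a))) ⟩
      sum (λ a → k (end a) * f a) ∎

    sum-potential : ∀ (k : Fin n → Carrier) (f : Fin m → Carrier) →
      sum (λ v → k v * net f v) ≈ sum (λ a → (k (tail a) - k (head a)) * f a)
    sum-potential k f = begin
      sum (λ v → k v * net f v)
        ≈⟨ sum-cong-≋ (λ v → x[y-z]≈xy-xz (k v) _ _) ⟩
      sum (λ v → k v * sum (λ a → ⟦ does (tail a ≟ v) ⟧ * f a) - k v * sum (λ a → ⟦ does (head a ≟ v) ⟧ * f a))
        ≈⟨ sum-distrib-- (λ v → k v * sum (λ a → ⟦ does (tail a ≟ v) ⟧ * f a)) _ ⟩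
      sum (λ v → k v * sum (λ a → ⟦ does (tail a ≟ v) ⟧ * f a)) - sum (λ v → k v * sum (λ a → ⟦ does (head a ≟ v) ⟧ * f a))
        ≈⟨ +-cong (sum-incident tail k f) (-‿cong (sum-incident head k f)) ⟩
      sum (λ a → k (tail a) * f a) - sum (λ a → k (head a) * f a)
        ≈⟨ sum-distrib-- (λ a → k (tail a) * f a) _ ⟨
      sum (λ a → k (tail a) * f a - k (head a) * f a)
        ≈⟨ sum-cong-≋ (λ a → ≈-sym ([y-z]x≈yx-zx (f a) _ _)) ⟩
      sum (λ a → (k (tail a) - k (head a)) * f a) ∎

-- The integers serve the rounded flow; the rationals serve the individual terms of Cauchy
-- sequences, where linear identities between reals are checked.
module Sumℤ = NetFlow ℤ.+-*-commutativeRing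
module Sumℚ = NetFlow ℚ.+-*-commutativeRing
open Sumℤ using (⟦_⟧; net) renaming (sum to sumℤ)
open Sumℚ using () renaming (sum to sumℚ; ⟦_⟧ to ⟦_⟧ℚ)
open RawMonoidSum +ℝ-rawMonoid using () renaming (sum to sumℝ; _×_ to _×ℝ_)
open RawMonoidSum ℕ.+-0-rawMonoid using () renaming (sum to sumℕ)

-- Parity of symmetric sums

Even : ℤ → Set
Even z = ∃[ k ] z ≡ + 2 ℤ.* k

sumℤ-mono-≤ : ∀ {m} {f g : Fin m → ℤ} → (∀ a → f a ℤ.≤ g a) → sumℤ f ℤ.≤ sumℤ g
sumℤ-mono-≤ {zero}  h = ℤ.≤-refl
sumℤ-mono-≤ {suc m} h = ℤ.+-mono-≤ (h zero) (sumℤ-mono-≤ (h ∘ suc))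

sumℤ-zero : ∀ m → sumℤ {m} (λ _ → 0ℤ) ≡ 0ℤ
sumℤ-zero m = Sumℤ.sum-replicate-zero m

module _ {m} (σ : Fin m → Fin m) (σ-inv : ∀ a → σ (σ a) ≡ a) where

  sumℤ-involution : ∀ f → sumℤ (f ∘ σ) ≡ sumℤ f
  sumℤ-involution f = sym (Sumℤ.sum-permute f (permutation σ σ σ-inv σ-inv))

  -- Selects one representative of each orbit, so that a symmetric sum is twice its part over the
  -- representatives.
  lower : Fin m → ℤ
  lower a = ⟦ does (a Fin.<? σ a) ⟧

  lower+lower-σ : (∀ a → σ a ≢ a) → ∀ a → lower a ℤ.+ lower (σ a) ≡ 1ℤ
  lower+lower-σ σ≢ a rewrite σ-inv a with Fin.<-cmp a (σ a)
  ... | tri< p _ q rewrite dec-true (a Fin.<? σ a) p | dec-false (σ a Fin.<? a) q = refl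
  ... | tri≈ _ p _ = ⊥-elim (σ≢ a (sym p))
  ... | tri> p _ q rewrite dec-false (a Fin.<? σ a) p | dec-true (σ a Fin.<? a) q = refl

  sumℤ-symmetric-even : (∀ a → σ a ≢ a) → ∀ f → (∀ a → f (σ a) ≡ f a) → Even (sumℤ f)
  sumℤ-symmetric-even σ≢ f f-sym = sumℤ g , (begin
    sumℤ f                          ≡⟨ Sumℤ.sum-cong-≗ split ⟩
    sumℤ (λ a → g a ℤ.+ g (σ a))    ≡⟨ Sumℤ.∑-distrib-+ g (g ∘ σ) ⟩
    sumℤ g ℤ.+ sumℤ (g ∘ σ)         ≡⟨ cong (ℤ._+_ (sumℤ g)) (sumℤ-involution g) ⟩
    sumℤ g ℤ.+ sumℤ g               ≡⟨ double (sumℤ g) ⟩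
    + 2 ℤ.* sumℤ g                  ∎)
    where
    open ≡.≡-Reasoning
    g : Fin m → ℤ
    g a = lower a ℤ.* f a
    double : ∀ x → x ℤ.+ x ≡ + 2 ℤ.* x
    double = ℤ-Solver.solve-∀
    split : ∀ a → f a ≡ g a ℤ.+ g (σ a)
    split a = begin
      f a                                          ≡⟨ ℤ.*-identityˡ (f a) ⟨
      1ℤ ℤ.* f a                                   ≡⟨ cong (ℤ._* f a) (lower+lower-σ σ≢ a) ⟨
      (lower a ℤ.+ lower (σ a)) ℤ.* f a            ≡⟨ ℤ.*-distribʳ-+ (f a) (lower a) (lower (σ a)) ⟩
      lower a ℤ.* f a ℤ.+ lower (σ a) ℤ.* f a      ≡⟨ cong (λ x → g a ℤ.+ lower (σ a) ℤ.* x) (f-sym a) ⟨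
      g a ℤ.+ g (σ a)                              ∎

sumℤ-nonNeg : ∀ {m} {f : Fin m → ℤ} → (∀ a → 0ℤ ℤ.≤ f a) → 0ℤ ℤ.≤ sumℤ f
sumℤ-nonNeg {m} {f} h = subst (ℤ._≤ sumℤ f) (sumℤ-zero m) (sumℤ-mono-≤ h)

-- Integer flows and the slack of a fragment

module Integral {n m} (N : SkewSymmetricNetwork n m) where
  open SkewSymmetricNetwork N

  netF : (Fin m → ℤ) → Fin n → ℤ
  netF = net tail head

  record IsISFlowℤ (F : Fin m → ℤ) : Set where
    field
      nonNegative  : ∀ a → 0ℤ ℤ.≤ F a
      capacity     : ∀ a → F a ℤ.≤ + u a
      conservation : ∀ v → v ≢ s → v ≢ s′ → netF F v ≡ 0ℤ
      symmetric    : ∀ a → F (σE a) ≡ F a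

  module Fragment (F : Fin m → ℤ) (flow : IsISFlowℤ F)
    (x : Fin n → Bool) (x-σ : ∀ v → x (σV v) ≡ x v) (s∉x : x s ≡ false) where
    open IsISFlowℤ flow
    open ≡.≡-Reasoning

    ent : Fin m → ℤ
    ent a = ⟦ x (head a) ⟧ ℤ.* (1ℤ ℤ.- ⟦ x (tail a) ⟧)

    -- Indicates one node of each pair v, σ v in x.
    y : Fin n → ℤ
    y v = ⟦ x v ⟧ ℤ.* lower σV σV-involutive v

    y-σ : ∀ v → y (σV v) ≡ ⟦ x v ⟧ ℤ.- y v
    y-σ v = begin
      ⟦ x (σV v) ⟧ ℤ.* l (σV v)            ≡⟨ cong (λ b → ⟦ b ⟧ ℤ.* l (σV v)) (x-σ v) ⟩
      ⟦ x v ⟧ ℤ.* l (σV v)                 ≡⟨ ring ⟦ x v ⟧ (l v) (l (σV v)) ⟩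
      ⟦ x v ⟧ ℤ.* (l v ℤ.+ l (σV v)) ℤ.- y v
        ≡⟨ cong (λ z → ⟦ x v ⟧ ℤ.* z ℤ.- y v) (lower+lower-σ σV σV-involutive σV-noFixed v) ⟩
      ⟦ x v ⟧ ℤ.* 1ℤ ℤ.- y v               ≡⟨ cong (ℤ._- y v) (ℤ.*-identityʳ ⟦ x v ⟧) ⟩
      ⟦ x v ⟧ ℤ.- y v                      ∎
      where
      l = lower σV σV-involutive
      ring : ∀ a b c → a ℤ.* c ≡ a ℤ.* (b ℤ.+ c) ℤ.- a ℤ.* b
      ring = ℤ-Solver.solve-∀

    -- Since `x` is self-symmetric, `s′` lies outside it together with `s`; hence `F` is conserved
    -- wherever `y` is nonzero.
    y-balance : sumℤ (λ a → (y (tail a) ℤ.- y (head a)) ℤ.* F a) ≡ 0ℤ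
    y-balance = begin
      sumℤ (λ a → (y (tail a) ℤ.- y (head a)) ℤ.* F a) ≡⟨ Sumℤ.sum-potential tail head y F ⟨
      sumℤ (λ v → y v ℤ.* netF F v)                    ≡⟨ Sumℤ.sum-cong-≗ term ⟩
      sumℤ {n} (λ _ → 0ℤ)                              ≡⟨ sumℤ-zero n ⟩
      0ℤ                                               ∎
      where
      outside : ∀ v → x v ≡ false → y v ℤ.* netF F v ≡ 0ℤ
      outside v eq rewrite eq = refl
      term : ∀ v → y v ℤ.* netF F v ≡ 0ℤ
      term v with v ≟ s | v ≟ s′
      ... | yes refl | _ = outside v s∉x
      ... | no _ | yes refl = outside v (trans (x-σ s) s∉x)
      ... | no v≢s | no v≢s′ = trans (cong (y v ℤ.*_) (conservation v v≢s v≢s′)) (ℤ.*-zeroʳ (y v))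

    -- Adding the zero of y-balance makes the weights symmetric.
    ent-even : Even (sumℤ λ a → ent a ℤ.* F a)
    ent-even = subst Even sum-q (sumℤ-symmetric-even σE σE-involutive σE-noFixed q q-σ)
      where
      q : Fin m → ℤ
      q a = (ent a ℤ.+ y (tail a) ℤ.- y (head a)) ℤ.* F a
      weight : ∀ xt xh yt yh →
        xt ℤ.* (1ℤ ℤ.- xh) ℤ.+ (xh ℤ.- yh) ℤ.- (xt ℤ.- yt) ≡ xh ℤ.* (1ℤ ℤ.- xt) ℤ.+ yt ℤ.- yh
      weight = ℤ-Solver.solve-∀
      q-σ : ∀ a → q (σE a) ≡ q a
      q-σ a rewrite tail-σE a | head-σE a | y-σ (tail a) | y-σ (head a)
                  | x-σ (tail a) | x-σ (head a) | symmetric a =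
        cong (ℤ._* F a) (weight ⟦ x (tail a) ⟧ ⟦ x (head a) ⟧ (y (tail a)) (y (head a)))
      ring : ∀ e t h f → (e ℤ.+ t ℤ.- h) ℤ.* f ≡ e ℤ.* f ℤ.+ (t ℤ.- h) ℤ.* f
      ring = ℤ-Solver.solve-∀
      sum-q : sumℤ q ≡ sumℤ (λ a → ent a ℤ.* F a)
      sum-q = begin
        sumℤ q ≡⟨ Sumℤ.sum-cong-≗ (λ a → ring (ent a) (y (tail a)) (y (head a)) (F a)) ⟩
        sumℤ (λ a → ent a ℤ.* F a ℤ.+ (y (tail a) ℤ.- y (head a)) ℤ.* F a)
          ≡⟨ Sumℤ.∑-distrib-+ (λ a → ent a ℤ.* F a) _ ⟩
        sumℤ (λ a → ent a ℤ.* F a) ℤ.+ sumℤ (λ a → (y (tail a) ℤ.- y (head a)) ℤ.* F a)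
          ≡⟨ cong (ℤ._+_ (sumℤ λ a → ent a ℤ.* F a)) y-balance ⟩
        sumℤ (λ a → ent a ℤ.* F a) ℤ.+ 0ℤ ≡⟨ ℤ.+-identityʳ _ ⟩
        sumℤ (λ a → ent a ℤ.* F a) ∎

    module _ (U : Fin m → Bool) where

      χ⁺ χ± slack : Fin m → ℤ
      χ⁺ a = + 2 ℤ.* ⟦ U a ⟧ ℤ.- ent a
      χ± a = χ⁺ a ℤ.+ χ⁺ (σE a)
      slack a = ⟦ U a ⟧ ℤ.* (+ u a ℤ.- F a) ℤ.+ (ent a ℤ.- ⟦ U a ⟧) ℤ.* F a

      cap : ℤ
      cap = sumℤ λ a → ⟦ U a ⟧ ℤ.* + u a

      sum-χ⁺ : sumℤ (λ a → χ⁺ a ℤ.* F a) ≡ cap ℤ.- sumℤ slack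
      sum-χ⁺ = begin
        sumℤ (λ a → χ⁺ a ℤ.* F a) ≡⟨ Sumℤ.sum-cong-≗ (λ a → ring ⟦ U a ⟧ (ent a) (F a) (+ u a)) ⟩
        sumℤ (λ a → ⟦ U a ⟧ ℤ.* + u a ℤ.- slack a) ≡⟨ Sumℤ.sum-distrib-- (λ a → ⟦ U a ⟧ ℤ.* + u a) slack ⟩
        cap ℤ.- sumℤ slack ∎
        where
        ring : ∀ i e f c → (+ 2 ℤ.* i ℤ.- e) ℤ.* f ≡ i ℤ.* c ℤ.- (i ℤ.* (c ℤ.- f) ℤ.+ (e ℤ.- i) ℤ.* f)
        ring = ℤ-Solver.solve-∀

      -- Hence the fragment constraint for `F` amounts to a total slack of at least one, with
      -- equality when it is tight.
      sum-χ± : sumℤ (λ a → χ± a ℤ.* F a) ≡ + 2 ℤ.* (cap ℤ.- sumℤ slack)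
      sum-χ± = begin
        sumℤ (λ a → χ± a ℤ.* F a)
          ≡⟨ Sumℤ.sum-cong-≗ (λ a → trans (ℤ.*-distribʳ-+ (F a) (χ⁺ a) (χ⁺ (σE a)))
               (cong (λ z → χ⁺ a ℤ.* F a ℤ.+ χ⁺ (σE a) ℤ.* z) (sym (symmetric a)))) ⟩
        sumℤ (λ a → χ⁺ a ℤ.* F a ℤ.+ χ⁺ (σE a) ℤ.* F (σE a))
          ≡⟨ Sumℤ.∑-distrib-+ (λ a → χ⁺ a ℤ.* F a) _ ⟩
        sumℤ (λ a → χ⁺ a ℤ.* F a) ℤ.+ sumℤ (λ a → χ⁺ (σE a) ℤ.* F (σE a))
          ≡⟨ cong (ℤ._+_ (sumℤ λ a → χ⁺ a ℤ.* F a)) (sumℤ-involution σE σE-involutive λ a → χ⁺ a ℤ.* F a) ⟩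
        sumℤ (λ a → χ⁺ a ℤ.* F a) ℤ.+ sumℤ (λ a → χ⁺ a ℤ.* F a)
          ≡⟨ double _ ⟩
        + 2 ℤ.* sumℤ (λ a → χ⁺ a ℤ.* F a) ≡⟨ cong (+ 2 ℤ.*_) sum-χ⁺ ⟩
        + 2 ℤ.* (cap ℤ.- sumℤ slack) ∎
        where
        double : ∀ z → z ℤ.+ z ≡ + 2 ℤ.* z
        double = ℤ-Solver.solve-∀

      -- The difference is twice the flow on `U` minus the flow entering `x`, and the latter is even
      -- by `ent-even`.
      cap-slack-even : Even (cap ℤ.- sumℤ slack)
      cap-slack-even = halve ent-even
        where
        ring : ∀ i e f → (+ 2 ℤ.* i ℤ.- e) ℤ.* f ≡ + 2 ℤ.* (i ℤ.* f) ℤ.- e ℤ.* f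
        ring = ℤ-Solver.solve-∀
        factor : ∀ z k → + 2 ℤ.* z ℤ.- + 2 ℤ.* k ≡ + 2 ℤ.* (z ℤ.- k)
        factor = ℤ-Solver.solve-∀
        halve : Even (sumℤ λ a → ent a ℤ.* F a) → Even (cap ℤ.- sumℤ slack)
        halve (k , eq) = sumℤ (λ a → ⟦ U a ⟧ ℤ.* F a) ℤ.- k , (begin
          cap ℤ.- sumℤ slack ≡⟨ sum-χ⁺ ⟨
          sumℤ (λ a → χ⁺ a ℤ.* F a) ≡⟨ Sumℤ.sum-cong-≗ (λ a → ring ⟦ U a ⟧ (ent a) (F a)) ⟩
          sumℤ (λ a → + 2 ℤ.* (⟦ U a ⟧ ℤ.* F a) ℤ.- ent a ℤ.* F a)
            ≡⟨ Sumℤ.sum-distrib-- (λ a → + 2 ℤ.* (⟦ U a ⟧ ℤ.* F a)) _ ⟩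
          sumℤ (λ a → + 2 ℤ.* (⟦ U a ⟧ ℤ.* F a)) ℤ.- sumℤ (λ a → ent a ℤ.* F a)
            ≡⟨ cong₂ ℤ._-_ (sym (Sumℤ.*-distribˡ-sum (+ 2) λ a → ⟦ U a ⟧ ℤ.* F a)) eq ⟩
          + 2 ℤ.* sumℤ (λ a → ⟦ U a ⟧ ℤ.* F a) ℤ.- + 2 ℤ.* k ≡⟨ factor (sumℤ λ a → ⟦ U a ⟧ ℤ.* F a) k ⟩
          + 2 ℤ.* (sumℤ (λ a → ⟦ U a ⟧ ℤ.* F a) ℤ.- k) ∎)

      -- Odd capacity makes the slack odd, hence positive.
      fragment-bound : (∀ a → U a ≡ true → x (head a) ≡ true × x (tail a) ≡ false) → ¬ Even cap →
        sumℤ (λ a → χ± a ℤ.* F a) ℤ.≤ + 2 ℤ.* cap ℤ.- + 2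
      fragment-bound U⊆ odd = subst₂ ℤ._≤_ (sym sum-χ±) (factor cap)
        (ℤ.*-monoˡ-≤-nonNeg (+ 2) (ℤ.+-monoʳ-≤ cap (ℤ.neg-mono-≤ 1≤slack)))
        where
        factor : ∀ z → + 2 ℤ.* (z ℤ.- 1ℤ) ≡ + 2 ℤ.* z ℤ.- + 2
        factor = ℤ-Solver.solve-∀
        slack-nonNeg : ∀ a → 0ℤ ℤ.≤ slack a
        slack-nonNeg a with U a | U⊆ a
        ... | true | U⊆a with U⊆a refl
        ...   | xh , xt rewrite xh | xt = subst (0ℤ ℤ.≤_) (ring (+ u a) (F a)) (ℤ.i≤j⇒0≤j-i (capacity a))
          where
          ring : ∀ c f → c ℤ.- f ≡ 1ℤ ℤ.* (c ℤ.- f) ℤ.+ 0ℤ ℤ.* f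
          ring = ℤ-Solver.solve-∀
        slack-nonNeg a | false | _ with x (head a) | x (tail a)
        ... | true  | true  = ℤ.≤-refl
        ... | true  | false = subst (0ℤ ℤ.≤_) (sym (trans (ℤ.+-identityˡ _) (ℤ.*-identityˡ (F a)))) (nonNegative a)
        ... | false | _     = ℤ.≤-refl
        1≤slack : 1ℤ ℤ.≤ sumℤ slack
        1≤slack = ℤ.i<j⇒suc[i]≤j (ℤ.≰⇒> λ slack≤0 → odd (subst Even
          (trans (cong (λ z → cap ℤ.- z) (ℤ.≤-antisym slack≤0 (sumℤ-nonNeg slack-nonNeg))) (ℤ.+-identityʳ cap))
          cap-slack-even))

      module _ (slack≡1 : sumℤ slack ≡ 1ℤ) where

        -- Parity used in the other direction: slack one forces odd capacity, so a component
        -- qualifies as an odd fragment without its capacity being computed.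
        tight-odd : ¬ Even cap
        tight-odd (j , eq) = absurd cap-slack-even
          where
          absurd : ¬ Even (cap ℤ.- sumℤ slack)
          absurd (k , eq′) = 2∤1 (j ℤ.- k) (begin
            + 2 ℤ.* (j ℤ.- k)              ≡⟨ factor j k ⟩
            + 2 ℤ.* j ℤ.- + 2 ℤ.* k        ≡⟨ cong₂ ℤ._-_ (sym eq) (sym eq′) ⟩
            cap ℤ.- (cap ℤ.- sumℤ slack)   ≡⟨ cancel cap (sumℤ slack) ⟩
            sumℤ slack                     ≡⟨ slack≡1 ⟩
            1ℤ                             ∎)
            where
            factor : ∀ j k → + 2 ℤ.* (j ℤ.- k) ≡ + 2 ℤ.* j ℤ.- + 2 ℤ.* k
            factor = ℤ-Solver.solve-∀
            cancel : ∀ c z → c ℤ.- (c ℤ.- z) ≡ z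
            cancel = ℤ-Solver.solve-∀
            2∤1 : ∀ i → + 2 ℤ.* i ≢ 1ℤ
            2∤1 i eq = 2≢1 (ℕ.m*n≡1⇒m≡1 2 ℤ.∣ i ∣ (trans (sym (ℤ.abs-* (+ 2) i)) (cong ℤ.∣_∣ eq)))
              where
              2≢1 : 2 ≢ 1
              2≢1 ()

        tight : sumℤ (λ a → χ± a ℤ.* F a) ≡ + 2 ℤ.* cap ℤ.- + 2
        tight = trans sum-χ± (trans (cong (λ z → + 2 ℤ.* (cap ℤ.- z)) slack≡1) (factor cap))
          where
          factor : ∀ z → + 2 ℤ.* (z ℤ.- 1ℤ) ≡ + 2 ℤ.* z ℤ.- + 2
          factor = ℤ-Solver.solve-∀

-- The reals as an ordered group

ι : ℤ → ℚ
ι z = z / 1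

-- `z / 1` does not reduce for a variable `z`, because normalisation takes a gcd; the laws for `ι`
-- are therefore proved on unnormalised fractions.
toℚᵘ-ι : ∀ z → toℚᵘ (ι z) ℚᵘ.≃ mkℚᵘ z 0
toℚᵘ-ι z = ℚ.toℚᵘ-fromℚᵘ (mkℚᵘ z 0)

ι-+ : ∀ x y → ι (x ℤ.+ y) ≡ ι x ℚ.+ ι y
ι-+ x y = ℚ.toℚᵘ-injective (begin
  toℚᵘ (ι (x ℤ.+ y))               ≈⟨ toℚᵘ-ι (x ℤ.+ y) ⟩
  mkℚᵘ (x ℤ.+ y) 0                 ≡⟨ cong (λ z → mkℚᵘ z 0) (cong₂ ℤ._+_ (ℤ.*-identityʳ x) (ℤ.*-identityʳ y)) ⟨
  mkℚᵘ x 0 ℚᵘ.+ mkℚᵘ y 0           ≈⟨ ℚᵘ.+-cong (toℚᵘ-ι x) (toℚᵘ-ι y) ⟨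
  toℚᵘ (ι x) ℚᵘ.+ toℚᵘ (ι y)       ≈⟨ ℚ.toℚᵘ-homo-+ (ι x) (ι y) ⟨
  toℚᵘ (ι x ℚ.+ ι y)               ∎)
  where open import Relation.Binary.Reasoning.Setoid ℚᵘ.≃-setoid

ι-* : ∀ x y → ι (x ℤ.* y) ≡ ι x ℚ.* ι y
ι-* x y = ℚ.toℚᵘ-injective (begin
  toℚᵘ (ι (x ℤ.* y))               ≈⟨ toℚᵘ-ι (x ℤ.* y) ⟩
  mkℚᵘ x 0 ℚᵘ.* mkℚᵘ y 0           ≈⟨ ℚᵘ.*-cong (toℚᵘ-ι x) (toℚᵘ-ι y) ⟨
  toℚᵘ (ι x) ℚᵘ.* toℚᵘ (ι y)       ≈⟨ ℚ.toℚᵘ-homo-* (ι x) (ι y) ⟨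
  toℚᵘ (ι x ℚ.* ι y)               ∎)
  where open import Relation.Binary.Reasoning.Setoid ℚᵘ.≃-setoid

ι-neg : ∀ x → ι (ℤ.- x) ≡ ℚ.- ι x
ι-neg x = ℚ.toℚᵘ-injective (begin
  toℚᵘ (ι (ℤ.- x))                 ≈⟨ toℚᵘ-ι (ℤ.- x) ⟩
  ℚᵘ.- mkℚᵘ x 0                    ≈⟨ ℚᵘ.-‿cong (toℚᵘ-ι x) ⟨
  ℚᵘ.- toℚᵘ (ι x)                  ≈⟨ ℚ.toℚᵘ-homo‿- (ι x) ⟨
  toℚᵘ (ℚ.- ι x)                   ∎)
  where open import Relation.Binary.Reasoning.Setoid ℚᵘ.≃-setoid

ι-mono-≤ : ∀ {x y} → x ℤ.≤ y → ι x ℚ.≤ ι y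
ι-mono-≤ {x} {y} x≤y = ℚ.toℚᵘ-cancel-≤ (ℚᵘ.≤-respˡ-≃ (ℚᵘ.≃-sym (toℚᵘ-ι x))
  (ℚᵘ.≤-respʳ-≃ (ℚᵘ.≃-sym (toℚᵘ-ι y)) (*≤* (ℤ.*-monoʳ-≤-nonNeg 1ℤ x≤y))))

ι-sum : ∀ {m} (f : Fin m → ℤ) → ι (sumℤ f) ≡ sumℚ (ι ∘ f)
ι-sum {zero}  f = refl
ι-sum {suc m} f = trans (ι-+ (f zero) _) (cong (ι (f zero) ℚ.+_) (ι-sum (f ∘ suc)))

half : ℚ → ℚ
half ε = ½ ℚ.* ε

0<half : ∀ {ε} → 0ℚ ℚ.< ε → 0ℚ ℚ.< half ε
0<half {ε} 0<ε = subst (ℚ._< half ε) (ℚ.*-zeroʳ ½) (ℚ.*-monoʳ-<-pos ½ 0<ε)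

half+half : ∀ ε → half ε ℚ.+ half ε ≡ ε
half+half ε = trans (sym (ℚ.*-distribʳ-+ ε ½ ½)) (ℚ.*-identityˡ ε)

p≤∣p∣ : ∀ p → p ℚ.≤ ∣ p ∣
p≤∣p∣ p with ℚ.∣p∣≡p∨∣p∣≡-p p
... | inj₁ eq = ℚ.≤-reflexive (sym eq)
... | inj₂ eq with ℚ.≤-total p 0ℚ
...   | inj₁ p≤0 = ℚ.≤-trans p≤0 (ℚ.0≤∣p∣ p)
...   | inj₂ 0≤p = ℚ.≤-reflexive (sym (ℚ.0≤p⇒∣p∣≡p 0≤p))

-<⇒<+ : ∀ {p q ε} → p ℚ.- q ℚ.< ε → p ℚ.< q ℚ.+ ε
-<⇒<+ {p} {q} {ε} h = subst (ℚ._< q ℚ.+ ε)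
  (solve 2 (λ p q → q :+ (p :- q) := p) refl p q) (ℚ.+-monoʳ-< q h)
  where open +-*-Solver

<+⇒-< : ∀ {p q ε} → p ℚ.< q ℚ.+ ε → p ℚ.- q ℚ.< ε
<+⇒-< {p} {q} {ε} h = subst (p ℚ.- q ℚ.<_)
  (solve 2 (λ q ε → q :+ ε :- q := ε) refl q ε) (ℚ.+-monoˡ-< (ℚ.- q) h)
  where open +-*-Solver

∣-∣<⇒<+ : ∀ {p q ε} → ∣ p ℚ.- q ∣ ℚ.< ε → p ℚ.< q ℚ.+ ε
∣-∣<⇒<+ h = -<⇒<+ (ℚ.≤-<-trans (p≤∣p∣ _) h)

∣-∣-comm : ∀ p q → ∣ p ℚ.- q ∣ ≡ ∣ q ℚ.- p ∣
∣-∣-comm p q = trans (sym (ℚ.∣-p∣≡∣p∣ (p ℚ.- q)))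
  (cong ∣_∣ (solve 2 (λ p q → :- (p :- q) := q :- p) refl p q))
  where open +-*-Solver

<+⇒∣-∣< : ∀ {p q ε} → p ℚ.< q ℚ.+ ε → q ℚ.< p ℚ.+ ε → ∣ p ℚ.- q ∣ ℚ.< ε
<+⇒∣-∣< {p} {q} {ε} h k with ℚ.∣p∣≡p∨∣p∣≡-p (p ℚ.- q)
... | inj₁ eq = subst (ℚ._< ε) (sym eq) (<+⇒-< h)
... | inj₂ eq = subst (ℚ._< ε)
  (sym (trans eq (solve 2 (λ p q → :- (p :- q) := q :- p) refl p q))) (<+⇒-< k)
  where open +-*-Solver

≤ℝ-pointwise : ∀ {x y} → (∀ n → seq x n ℚ.≤ seq y n) → x ≤ℝ y
≤ℝ-pointwise {x} {y} h ε 0<ε = 0 , λ n _ → ℚ.≤-<-trans (h n)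
  (subst (ℚ._< seq y n ℚ.+ ε) (ℚ.+-identityʳ _) (ℚ.+-monoʳ-< (seq y n) 0<ε))

≃⇒≤ : ∀ {x y} → x ≃ y → x ≤ℝ y
≃⇒≤ {x} {y} h ε 0<ε with h ε 0<ε
... | N , p = N , λ n N≤n → ∣-∣<⇒<+ {seq x n} {seq y n} (p n N≤n)

≃-sym : ∀ {x y} → x ≃ y → y ≃ x
≃-sym {x} {y} h ε 0<ε with h ε 0<ε
... | N , p = N , λ n N≤n → subst (ℚ._< ε) (∣-∣-comm (seq x n) (seq y n)) (p n N≤n)

≤ℝ-antisym : ∀ {x y} → x ≤ℝ y → y ≤ℝ x → x ≃ y
≤ℝ-antisym {x} {y} h k ε 0<ε with h ε 0<ε | k ε 0<ε
... | M , p | N , q = M ℕ.⊔ N , λ n ≤n →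
  <+⇒∣-∣< {seq x n} {seq y n} (p n (ℕ.m⊔n≤o⇒m≤o M N ≤n)) (q n (ℕ.m⊔n≤o⇒n≤o M N ≤n))

≃-pointwise : ∀ {x y} → (∀ n → seq x n ≡ seq y n) → x ≃ y
≃-pointwise {x} {y} h = ≤ℝ-antisym {x} {y} (≤ℝ-pointwise {x} {y} (ℚ.≤-reflexive ∘ h))
  (≤ℝ-pointwise {y} {x} (ℚ.≤-reflexive ∘ sym ∘ h))

≤ℝ-refl : ∀ {x} → x ≤ℝ x
≤ℝ-refl {x} = ≤ℝ-pointwise {x} {x} λ _ → ℚ.≤-refl

≤ℝ-trans : ∀ {x y z} → x ≤ℝ y → y ≤ℝ z → x ≤ℝ z
≤ℝ-trans {x} {y} {z} h k ε 0<ε with h (half ε) (0<half 0<ε) | k (half ε) (0<half 0<ε)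
... | M , p | N , q = M ℕ.⊔ N , λ n ≤n → ℚ.<-trans (p n (ℕ.m⊔n≤o⇒m≤o M N ≤n))
  (subst (seq y n ℚ.+ half ε ℚ.<_)
    (trans (ℚ.+-assoc (seq z n) (half ε) (half ε)) (cong (seq z n ℚ.+_) (half+half ε)))
    (ℚ.+-monoˡ-< (half ε) (q n (ℕ.m⊔n≤o⇒n≤o M N ≤n))))

≃-trans : ∀ {x y z} → x ≃ y → y ≃ z → x ≃ z
≃-trans {x} {y} {z} p q = ≤ℝ-antisym {x} {z}
  (≤ℝ-trans {x} {y} {z} (≃⇒≤ {x} {y} p) (≃⇒≤ {y} {z} q))
  (≤ℝ-trans {z} {y} {x} (≃⇒≤ {z} {y} (≃-sym {y} {z} q)) (≃⇒≤ {y} {x} (≃-sym {x} {y} p)))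

+ℝ-mono-≤ : ∀ {x y z w} → x ≤ℝ y → z ≤ℝ w → x +ℝ z ≤ℝ y +ℝ w
+ℝ-mono-≤ {x} {y} {z} {w} h k ε 0<ε with h (half ε) (0<half 0<ε) | k (half ε) (0<half 0<ε)
... | M , p | N , q = M ℕ.⊔ N , λ n ≤n →
  subst (seq x n ℚ.+ seq z n ℚ.<_)
    (trans (solve 4 (λ a b c d → (a :+ b) :+ (c :+ d) := (a :+ c) :+ (b :+ d)) refl
        (seq y n) (half ε) (seq w n) (half ε))
      (cong (seq y n ℚ.+ seq w n ℚ.+_) (half+half ε)))
    (ℚ.+-mono-< (p n (ℕ.m⊔n≤o⇒m≤o M N ≤n)) (q n (ℕ.m⊔n≤o⇒n≤o M N ≤n)))
  where open +-*-Solver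

-ℝ-antimono-≤ : ∀ {x y} → x ≤ℝ y → -ℝ y ≤ℝ -ℝ x
-ℝ-antimono-≤ {x} {y} h ε 0<ε with h ε 0<ε
... | N , p = N , λ n N≤n → subst₂ ℚ._<_
  (solve 2 (λ a b → a :+ (:- a :- b) := :- b) refl (seq x n) (seq y n))
  (solve 3 (λ a b e → b :+ e :+ (:- a :- b) := :- a :+ e) refl (seq x n) (seq y n) ε)
  (ℚ.+-monoˡ-< (ℚ.- seq x n ℚ.- seq y n) (p n N≤n))
  where open +-*-Solver

-- x ≤ℝ y can be decided up to ε from one late term of each sequence.
≤ℝ-stable : ∀ {x y} → ¬ ¬ (x ≤ℝ y) → x ≤ℝ y
≤ℝ-stable {x} {y} ¬¬h ε 0<ε
  with cauchy x (half (half ε)) (0<half (0<half 0<ε)) | cauchy y (half (half ε)) (0<half (0<half 0<ε))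
... | M , p | N , q = K , bound
  where
  open +-*-Solver
  K = M ℕ.⊔ N
  η = half (half ε)
  M≤ : ∀ {n} → K ℕ.≤ n → M ℕ.≤ n
  M≤ = ℕ.m⊔n≤o⇒m≤o M N
  N≤ : ∀ {n} → K ℕ.≤ n → N ℕ.≤ n
  N≤ = ℕ.m⊔n≤o⇒n≤o M N
  4η≡ε : (η ℚ.+ η) ℚ.+ (η ℚ.+ η) ≡ ε
  4η≡ε = trans (cong₂ ℚ._+_ (half+half (half ε)) (half+half (half ε))) (half+half ε)
  -- The budget `ε` is spent as one `η` for moving `x` from index `n` to `k`, two for the tolerance
  -- at `k`, and one for moving `y` back to `n`.
  late : ∀ {n k} → K ℕ.≤ n → K ℕ.≤ k → seq x k ℚ.< seq y k ℚ.+ (η ℚ.+ η) → seq x n ℚ.< seq y n ℚ.+ ε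
  late {n} {k} K≤n K≤k h = begin-strict
    seq x n                            <⟨ ∣-∣<⇒<+ {seq x n} {seq x k} (p n k (M≤ K≤n) (M≤ K≤k)) ⟩
    seq x k ℚ.+ η                      <⟨ ℚ.+-monoˡ-< η h ⟩
    seq y k ℚ.+ (η ℚ.+ η) ℚ.+ η        <⟨ ℚ.+-monoˡ-< η (ℚ.+-monoˡ-< (η ℚ.+ η)
                                            (∣-∣<⇒<+ {seq y k} {seq y n} (q k n (N≤ K≤k) (N≤ K≤n)))) ⟩
    seq y n ℚ.+ η ℚ.+ (η ℚ.+ η) ℚ.+ η  ≡⟨ solve 2 (λ y e → y :+ e :+ (e :+ e) :+ e
                                            := y :+ ((e :+ e) :+ (e :+ e))) refl (seq y n) η ⟩
    seq y n ℚ.+ ((η ℚ.+ η) ℚ.+ (η ℚ.+ η)) ≡⟨ cong (seq y n ℚ.+_) 4η≡ε ⟩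
    seq y n ℚ.+ ε                      ∎
    where open ℚ.≤-Reasoning
  bound : ∀ n → K ℕ.≤ n → seq x n ℚ.< seq y n ℚ.+ ε
  bound n K≤n with seq x n ℚ.<? seq y n ℚ.+ ε
  ... | yes h = h
  ... | no ¬h = ⊥-elim (¬¬h λ h → contra (h (η ℚ.+ η)
          (subst (0ℚ ℚ.<_) (sym (half+half (half ε))) (0<half 0<ε))))
    where
    contra : (∃[ L ] (∀ k → L ℕ.≤ k → seq x k ℚ.< seq y k ℚ.+ (η ℚ.+ η))) → ⊥
    contra (L , r) = ¬h (late K≤n (ℕ.m≤m⊔n K L) (r (K ℕ.⊔ L) (ℕ.m≤n⊔m K L)))

≃⇒≥ : ∀ {x y} → x ≃ y → y ≤ℝ x
≃⇒≥ {x} {y} h = ≃⇒≤ {y} {x} (≃-sym {x} {y} h)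

sumℝ-mono-≤ : ∀ {m} {f g : Fin m → ℝ} → (∀ a → f a ≤ℝ g a) → sumℝ f ≤ℝ sumℝ g
sumℝ-mono-≤ {zero}  h = ≤ℝ-refl {0ℝ}
sumℝ-mono-≤ {suc m} {f} {g} h =
  +ℝ-mono-≤ {f zero} {g zero} {sumℝ (f ∘ suc)} {sumℝ (g ∘ suc)} (h zero) (sumℝ-mono-≤ (h ∘ suc))

sumℝ-cong : ∀ {m} {f g : Fin m → ℝ} → (∀ a → f a ≃ g a) → sumℝ f ≃ sumℝ g
sumℝ-cong {f = f} {g} h = ≤ℝ-antisym {sumℝ f} {sumℝ g}
  (sumℝ-mono-≤ λ a → ≃⇒≤ {f a} {g a} (h a)) (sumℝ-mono-≤ λ a → ≃⇒≥ {f a} {g a} (h a))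

seq-sumℝ : ∀ {m} (f : Fin m → ℝ) n → seq (sumℝ f) n ≡ sumℚ λ a → seq (f a) n
seq-sumℝ {zero}  f n = refl
seq-sumℝ {suc m} f n = cong (seq (f zero) n ℚ.+_) (seq-sumℝ (f ∘ suc) n)

×ℝ-mono-≤ : ∀ k {x y} → x ≤ℝ y → k ×ℝ x ≤ℝ k ×ℝ y
×ℝ-mono-≤ zero    h = ≤ℝ-refl {0ℝ}
×ℝ-mono-≤ (suc k) {x} {y} h = +ℝ-mono-≤ {x} {y} {k ×ℝ x} {k ×ℝ y} h (×ℝ-mono-≤ k {x} {y} h)

·-cong : ∀ z {x y} → x ≃ y → z · x ≃ z · y
·-cong z {x} {y} h = ≤ℝ-antisym {z · x} {z · y} (mono z {x} {y} (≃⇒≤ {x} {y} h) (≃⇒≥ {x} {y} h))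
  (mono z {y} {x} (≃⇒≥ {x} {y} h) (≃⇒≤ {x} {y} h))
  where
  mono : ∀ z {x y} → x ≤ℝ y → y ≤ℝ x → z · x ≤ℝ z · y
  mono (+ k) {x} {y} p q = ×ℝ-mono-≤ k {x} {y} p
  mono -[1+ k ] {x} {y} p q = -ℝ-antimono-≤ {suc k ×ℝ y} {suc k ×ℝ x} (×ℝ-mono-≤ (suc k) {y} {x} q)

·-monoʳ-≤-nonNeg : ∀ {z x y} → 0ℤ ℤ.≤ z → x ≤ℝ y → z · x ≤ℝ z · y
·-monoʳ-≤-nonNeg {+ k} {x} {y} _ h = ×ℝ-mono-≤ k {x} {y} h

·-monoʳ-≤-nonPos : ∀ {z x y} → z ℤ.≤ 0ℤ → y ≤ℝ x → z · x ≤ℝ z · y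
·-monoʳ-≤-nonPos {z = -[1+ k ]} {x} {y} _ h = -ℝ-antimono-≤ {suc k ×ℝ y} {suc k ×ℝ x} (×ℝ-mono-≤ (suc k) {y} {x} h)
·-monoʳ-≤-nonPos {z = + zero} _ _ = ≤ℝ-refl {0ℝ}
·-monoʳ-≤-nonPos {z = + suc _} (ℤ.+≤+ ())

seq-×ℝ : ∀ k x n → seq (k ×ℝ x) n ≡ ι (+ k) ℚ.* seq x n
seq-×ℝ zero    x n = sym (ℚ.*-zeroˡ (seq x n))
seq-×ℝ (suc k) x n = trans (cong (seq x n ℚ.+_) (seq-×ℝ k x n))
  (trans (solve 2 (λ k x → x :+ k :* x := (con 1ℚ :+ k) :* x) refl (ι (+ k)) (seq x n))
    (cong (ℚ._* seq x n) (sym (ι-+ 1ℤ (+ k)))))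
  where open +-*-Solver

seq-· : ∀ z x n → seq (z · x) n ≡ ι z ℚ.* seq x n
seq-· (+ k)    x n = seq-×ℝ k x n
seq-· -[1+ k ] x n = trans (cong ℚ.-_ (seq-×ℝ (suc k) x n))
  (trans (ℚ.neg-distribˡ-* (ι (+ suc k)) (seq x n))
    (cong (ℚ._* seq x n) (sym (ι-neg (+ suc k)))))

-- At a late index, `y + ε ≤ x` would give `2y + 2ε ≤ 2x`, against `2x < 2y + ε`. The extra `0ℚ`
-- terms come from unfolding `(+ 2) · x`.
2·-cancel-≤ : ∀ {x y} → (+ 2) · x ≤ℝ (+ 2) · y → x ≤ℝ y
2·-cancel-≤ {x} {y} h ε 0<ε with h ε 0<ε
... | N , p = N , λ n N≤n → ℚ.≰⇒> λ k → ℚ.<-irrefl refl (ℚ.<-≤-trans (p n N≤n) (begin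
    seq y n ℚ.+ (seq y n ℚ.+ 0ℚ) ℚ.+ ε       ≤⟨ ℚ.<⇒≤ (subst (ℚ._< seq y n ℚ.+ (seq y n ℚ.+ 0ℚ) ℚ.+ ε ℚ.+ ε) (ℚ.+-identityʳ _)
                                               (ℚ.+-monoʳ-< (seq y n ℚ.+ (seq y n ℚ.+ 0ℚ) ℚ.+ ε) 0<ε)) ⟩
    seq y n ℚ.+ (seq y n ℚ.+ 0ℚ) ℚ.+ ε ℚ.+ ε ≡⟨ solve 2 (λ y e → y :+ (y :+ con 0ℚ) :+ e :+ e := (y :+ e) :+ ((y :+ e) :+ con 0ℚ)) refl (seq y n) ε ⟩
    (seq y n ℚ.+ ε) ℚ.+ ((seq y n ℚ.+ ε) ℚ.+ 0ℚ) ≤⟨ ℚ.+-mono-≤ k (ℚ.+-monoˡ-≤ 0ℚ k) ⟩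
    seq x n ℚ.+ (seq x n ℚ.+ 0ℚ)             ∎))
  where
  open +-*-Solver
  open ℚ.≤-Reasoning

fromℤ-mono-≤ : ∀ {x y} → x ℤ.≤ y → fromℤ x ≤ℝ fromℤ y
fromℤ-mono-≤ {x} {y} h = ≤ℝ-pointwise {fromℤ x} {fromℤ y} λ _ → ι-mono-≤ h

fromℤ-cancel-≤ : ∀ {x y} → fromℤ x ≤ℝ fromℤ y → x ℤ.≤ y
-- Tolerance one suffices because `y < x` already means `y + 1 ≤ x` for integers.
fromℤ-cancel-≤ {x} {y} h with h 1ℚ (ℚ.positive⁻¹ 1ℚ)
... | N , p = ℤ.≮⇒≥ λ y<x → ℚ.<-irrefl refl (ℚ.<-≤-trans (p N ℕ.≤-refl)
  (subst (ℚ._≤ ι x) (trans (ι-+ 1ℤ y) (ℚ.+-comm (ι 1ℤ) (ι y))) (ι-mono-≤ (ℤ.i<j⇒suc[i]≤j y<x))))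

-- Regular trails

module Trails
  {V E : Set} (_≟ᴱ_ : DecidableEquality E)
  (src tgt : E → V) (σ : V → V) (mate : E → E) (Avail : E → Set)
  (σ-inv : ∀ v → σ (σ v) ≡ v) (mate-inv : ∀ e → mate (mate e) ≡ e)
  (src-mate : ∀ e → src (mate e) ≡ σ (tgt e))
  (tgt-mate : ∀ e → tgt (mate e) ≡ σ (src e))
  (avail-mate : ∀ e → Avail e → Avail (mate e))
  (s : V)
  where

  Path : V → List E → V → Set
  Path v []       w = v ≡ w
  Path v (e ∷ es) w = v ≡ src e × Avail e × Path (tgt e) es w

  Clash : E → E → Set
  Clash d e = d ≡ e ⊎ d ≡ mate e

  clash? : ∀ d e → Dec (Clash d e)
  clash? d e = (d ≟ᴱ e) ⊎-dec (d ≟ᴱ mate e)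

  clash-sym : ∀ {d e} → Clash d e → Clash e d
  clash-sym (inj₁ refl) = inj₁ refl
  clash-sym {e = e} (inj₂ refl) = inj₂ (sym (mate-inv e))

  clash-mate : ∀ {d e} → Clash d e → Clash d (mate e)
  clash-mate {d} (inj₁ refl) = inj₂ (sym (mate-inv d))
  clash-mate     (inj₂ p)    = inj₁ p

  clash-mate⁻ : ∀ {d e} → Clash d (mate e) → Clash d e
  clash-mate⁻ {d} {e} c = subst (Clash d) (mate-inv e) (clash-mate c)

  Apart : List E → List E → Set
  Apart ds es = ∀ {d e} → d ∈ ds → e ∈ es → ¬ Clash d e

  Regular : List E → Set
  Regular = AllPairs λ d e → ¬ Clash d e

  regular-++⁺ : ∀ {ds es} → Regular ds → Regular es → Apart ds es → Regular (ds ++ es)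
  regular-++⁺ r q a = AllPairs.++⁺ r q (All.tabulate λ d∈ → All.tabulate λ e∈ → a d∈ e∈)

  regular-++⁻ : ∀ ds {es} → Regular (ds ++ es) → Regular ds × Regular es × Apart ds es
  regular-++⁻ []       r       = [] , r , λ ()
  regular-++⁻ (d ∷ ds) (p ∷ r) with regular-++⁻ ds r
  ... | r₁ , r₂ , a =
    All.tabulate (λ x∈ → All.lookup p (∈-++⁺ˡ x∈)) ∷ r₁ , r₂ ,
    λ { (here refl) y∈ → All.lookup p (∈-++⁺ʳ ds y∈) ; (there x∈) y∈ → a x∈ y∈ }

  path-++⁺ : ∀ ds {es u v w} → Path u ds v → Path v es w → Path u (ds ++ es) w
  path-++⁺ []       refl        q = q
  path-++⁺ (d ∷ ds) (p , a , r) q = p , a , path-++⁺ ds r q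

  path-++⁻ : ∀ ds {es u w} → Path u (ds ++ es) w → ∃[ v ] Path u ds v × Path v es w
  path-++⁻ []       q           = _ , refl , q
  path-++⁻ (d ∷ ds) (p , a , r) with path-++⁻ ds r
  ... | v , r₁ , r₂ = v , (p , a , r₁) , r₂

  -- The image of a path under the symmetry. Mates run from `σ` of the head to `σ` of the tail, so
  -- the order is reversed.
  mates : List E → List E
  mates []       = []
  mates (e ∷ es) = mates es ++ [ mate e ]

  ∈-mates⁻ : ∀ es {d} → d ∈ mates es → mate d ∈ es
  ∈-mates⁻ (e ∷ es) d∈ with ∈-++⁻ (mates es) d∈
  ... | inj₁ p           = there (∈-mates⁻ es p)
  ... | inj₂ (here refl) = here (mate-inv e)

  path-mates : ∀ es {v w} → Path v es w → Path (σ w) (mates es) (σ v)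
  path-mates []       refl           = refl
  path-mates (e ∷ es) (refl , a , p) = path-++⁺ (mates es) (path-mates es p)
    (sym (src-mate e) , avail-mate e a , tgt-mate e)

  regular-mates : ∀ es → Regular es → Regular (mates es)
  regular-mates []       _       = []
  regular-mates (e ∷ es) (p ∷ r) = regular-++⁺ (regular-mates es r) ([] ∷ [])
    λ { d∈ (here refl) c → All.lookup p (∈-mates⁻ es d∈) (clash-mate (clash-sym (clash-mate⁻ c))) }

  Trail : List E → V → Set
  Trail es v = Path s es v × Regular es

  Reachable : V → Set
  Reachable v = ∃[ es ] Trail es v

  trail-prefix : ∀ ds {e es v} → Trail (ds ++ e ∷ es) v → Trail ds (src e) × Trail (ds ++ [ e ]) (tgt e)
  trail-prefix ds {e} (p , r) with path-++⁻ ds p | regular-++⁻ ds r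
  ... | _ , p₁ , refl , av , _ | r₁ , _ , ap =
    (p₁ , r₁) ,
    path-++⁺ ds p₁ (refl , av , refl) ,
    regular-++⁺ r₁ ([] ∷ []) λ { d∈ (here refl) → ap d∈ (here refl) }

  -- Cutting at the first clash leaves a prefix that is apart from `es`, hence can be joined to
  -- parts of `es` or of its mates.
  data FirstClash (es : List E) : List E → Set where
    none  : ∀ {ds} → Apart ds es → FirstClash es ds
    first : ∀ ds d {ds′ e} → Apart ds es → e ∈ es → Clash d e → FirstClash es (ds ++ d ∷ ds′)

  firstClash : ∀ es ds → FirstClash es ds
  firstClash es []       = none λ ()
  firstClash es (d ∷ ds) with Any.any? (clash? d) es
  ... | yes c = let e , e∈ , p = find c in first [] d (λ ()) e∈ p
  ... | no ¬c with firstClash es ds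
  ...   | none a = none λ { (here refl) e∈ p → ¬c (lose e∈ p) ; (there x) → a x }
  ...   | first ds₁ d′ a e∈ p =
    first (d ∷ ds₁) d′ (λ { (here refl) e∈ p → ¬c (lose e∈ p) ; (there x) → a x }) e∈ p

  -- Appending `a` can fail only if `es` already contains `a` or `mate a`. In the first case the
  -- prefix through `a` is the desired trail; in the second the prefixes before and through `mate a`
  -- reach `σ (tgt a)` and `σ (src a)`. The inclusions in `es` let domination be transferred back to
  -- `es`.
  extend : ∀ {es} a → Avail a → Trail es (src a) →
    (∃[ ds ] Trail (ds ++ [ a ]) (tgt a) × (∀ {x} → x ∈ ds → x ∈ es)) ⊎
    (∃[ ds ] Trail ds (σ (tgt a)) × Trail (ds ++ [ mate a ]) (σ (src a)) ×
       (∀ {x} → x ∈ ds ++ [ mate a ] → x ∈ es))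
  extend {es} a av t@(p , r) with firstClash [ a ] es
  ... | none ap = inj₁ (es , (path-++⁺ es p (refl , av , refl) , regular-++⁺ r ([] ∷ []) ap) , λ x → x)
  ... | first ds d ap (here refl) (inj₁ refl) =
    inj₁ (ds , proj₂ (trail-prefix ds t) , ∈-++⁺ˡ)
  ... | first ds d {ds′} ap (here refl) (inj₂ refl) with trail-prefix ds t
  ...   | t₁ , t₂ = inj₂ (ds , subst (Trail ds) (src-mate a) t₁ , subst (Trail _) (tgt-mate a) t₂ ,
            λ x∈ → subst (_ ∈_) (++-assoc ds [ d ] ds′) (∈-++⁺ˡ x∈))

  -- Entries and domination

  Outer Inner : V → Set
  Outer v = Reachable v × ¬ Reachable (σ v)
  Inner v = Reachable v × Reachable (σ v)

  record Entry (e : E) : Set where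
    field
      avail : Avail e
      outer : Outer (src e)
      inner : Inner (tgt e)
  open Entry public

  -- Domination in the sense of flow graphs, for regular trails only.
  Dom : E → V → Set
  Dom e v = ∀ {es} → Trail es v → e ∈ es

  σ-inner : ∀ {v} → Inner v → Inner (σ v)
  σ-inner {v} (r , r′) = r′ , subst Reachable (sym (σ-inv v)) r

  -- A trail to `σ (tgt e)` ends where `mate e` starts. Appending `mate e` would reach the
  -- unreachable `σ (src e)`, so by `extend` the mate of `mate e`, which is `e`, is on the trail.
  entry-dom-σ : ∀ {e} → Entry e → Dom e (σ (tgt e))
  entry-dom-σ {e} E {es} (p , r)
    with extend (mate e) (avail-mate e (avail E)) (subst (Trail es) (sym (src-mate e)) (p , r))
  ... | inj₁ (ds , t , _) = ⊥-elim (proj₂ (outer E) (_ , subst (Trail _) (tgt-mate e) t))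
  ... | inj₂ (ds , _ , _ , inc) = subst (_∈ es) (mate-inv e) (inc (∈-++⁺ʳ ds (here refl)))

  -- A trail through `mate e` has a prefix that ends at `σ (src e)`.
  mate∉ : ∀ {e es v} → Entry e → Trail es v → mate e ∉ es
  mate∉ {e} E t m∈ with ∈-∃++ m∈
  ... | ds , _ , refl =
    proj₂ (outer E) (_ , subst (Trail _) (tgt-mate e) (proj₂ (trail-prefix ds t)))

  -- If a trail Q to z avoids e, follow Q until it first clashes with the part P of a
  -- trail to σ z behind e. From there on, either P leads to σ z avoiding e, or the
  -- mates of P lead back to the mate of e, so that σ (src e) is reachable.
  dom-σ : ∀ {e z} → Entry e → Reachable (σ z) → Dom e (σ z) → Dom e z
  dom-σ {e} {z} E (ps , t) dom {qs} tq with Any.any? (e ≟ᴱ_) qs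
  ... | yes e∈ = e∈
  ... | no e∉ with ∈-∃++ (dom t)
  ...   | ps₀ , S , refl with path-++⁻ ps₀ (proj₁ t) | regular-++⁻ ps₀ (proj₂ t)
  ...     | _ , _ , refl , _ , pS | _ , ra ∷ rS , _ = splice (firstClash S qs) e∉ tq
    where
    back : ∀ {ds x} → Path s ds x → Regular ds → e ∉ ds → mate e ∉ ds →
           ∀ T → Path (tgt e) T (σ x) → Regular (e ∷ T) → Apart ds T → ⊥
    back {ds} {x} pd rd e∉ e′∉ T pT rT ap = proj₂ (outer E)
      (ds ++ mates (e ∷ T) ,
        path-++⁺ ds pd (subst (λ y → Path y (mates (e ∷ T)) _) (σ-inv x)
          (path-mates (e ∷ T) (refl , avail E , pT))) ,
        regular-++⁺ rd (regular-mates (e ∷ T) rT) cross)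
      where
      cross : Apart ds (mates (e ∷ T))
      cross d∈ m∈ c with ∈-mates⁻ (e ∷ T) m∈
      ... | there x∈ = ap d∈ x∈ (clash-mate c)
      ... | here eq with subst (Clash _) eq (clash-mate c)
      ...   | inj₁ refl = e∉ d∈
      ...   | inj₂ refl = e′∉ d∈

    splice : ∀ {qs} → FirstClash S qs → e ∉ qs → Trail qs z → e ∈ qs
    splice (none ap) e∉ tq@(pq , rq) = ⊥-elim (back pq rq e∉ (mate∉ E tq) S pS (ra ∷ rS) ap)
    splice (first ds d {ds′} ap x∈ c) e∉ tq with ∈-∃++ x∈
    ... | S₁ , S₂ , refl with path-++⁻ S₁ pS | regular-++⁻ S₁ rS | trail-prefix ds tq
    ... | _ , pS₁ , refl , av , pS₂ | rS₁ , rS₂ , apS | (pd , rd) , _ with c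
    -- `d` itself lies on the part behind `e`: following that part from `d` on gives a trail to
    -- `σ z`. It avoids `e`, which occurs only once on the original trail, and this contradicts
    -- `dom`.
    ...   | inj₁ refl = ⊥-elim (contra (∈-++⁻ ds (dom (path-++⁺ ds pd (refl , av , pS₂) ,
                          regular-++⁺ rd rS₂ λ a∈ b∈ → ap a∈ (∈-++⁺ʳ S₁ b∈)))))
      where
      contra : e ∈ ds ⊎ e ∈ d ∷ S₂ → ⊥
      contra (inj₁ e∈) = e∉ (∈-++⁺ˡ e∈)
      contra (inj₂ e∈) = All.lookup ra (∈-++⁺ʳ S₁ e∈) (inj₁ refl)
    -- The mate of `d` lies on the part behind `e`. Up to and including this mate, that part ends at
    -- `σ (src d)`, so its mates start where `ds` ends.
    ...   | inj₂ refl = ⊥-elim (back pd rd (λ e∈ → e∉ (∈-++⁺ˡ e∈)) (mate∉ E (pd , rd))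
              (S₁ ++ [ _ ])
              (path-++⁺ S₁ pS₁ (refl , av , trans (sym (σ-inv _)) (cong σ (sym (src-mate _)))))
              (All.tabulate (λ y∈ → All.lookup ra (pre y∈)) ∷
                regular-++⁺ rS₁ ([] ∷ []) (λ { a∈ (here refl) → apS a∈ (here refl) }))
              (λ a∈ b∈ → ap a∈ (pre b∈)))
      where
      pre : ∀ {y x} → y ∈ S₁ ++ [ x ] → y ∈ S₁ ++ x ∷ S₂
      pre y∈ with ∈-++⁻ S₁ y∈
      ... | inj₁ y∈S₁        = ∈-++⁺ˡ y∈S₁
      ... | inj₂ (here refl) = ∈-++⁺ʳ S₁ (here refl)

  dom-σ⁻ : ∀ {e z} → Entry e → Inner z → Dom e z → Dom e (σ z)
  dom-σ⁻ {e} {z} E (r , _) dom =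
    dom-σ E (subst Reachable (sym (σ-inv z)) r) (subst (Dom e) (sym (σ-inv z)) dom)

  -- Nothing direct prevents a trail from reaching `tgt e` by another arc; domination is forced at
  -- `σ (tgt e)` and carried over by symmetry.
  entry-dom : ∀ {e} → Entry e → Dom e (tgt e)
  entry-dom E = dom-σ E (proj₂ (inner E)) (entry-dom-σ E)

  -- The arc `a` points the wrong way for extending trails to `tgt a`, but `mate a` leaves
  -- `σ (tgt a)`. Trails to `σ (tgt a)` thus extend to `σ (src a)`, where `e` dominates, or already
  -- pass through `a` and so through `src a`. The added arc is not `e`, since its source is inner;
  -- `dom-σ` returns to `tgt a`.
  dom-arc : ∀ {e} a → Entry e → Avail a → Inner (src a) → Inner (tgt a) →
    Dom e (src a) → Dom e (tgt a)
  dom-arc {e} a E av iy iz dom = dom-σ E (proj₂ iz) dom-σz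
    where
    dom-σz : Dom e (σ (tgt a))
    dom-σz {es} t with extend (mate a) (avail-mate a av) (subst (Trail es) (sym (src-mate a)) t)
    ... | inj₂ (ds , t₁ , _ , inc) = inc (∈-++⁺ˡ (dom (subst (Trail ds)
            (trans (cong σ (tgt-mate a)) (σ-inv (src a))) t₁)))
    ... | inj₁ (ds , t₁ , inc) with ∈-++⁻ ds (dom-σ⁻ E iy dom (subst (Trail _) (tgt-mate a) t₁))
    ...   | inj₁ e∈          = inc e∈
    ...   | inj₂ (here refl) = ⊥-elim (proj₂ (outer E)
              (subst Reachable (sym (trans (cong σ (src-mate a)) (σ-inv (tgt a)))) (proj₁ iz)))

  SameDom : V → V → Set
  SameDom y z = ∀ {e} → Entry e → (Dom e y → Dom e z) × (Dom e z → Dom e y)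

  sameDom-refl : ∀ {z} → SameDom z z
  sameDom-refl _ = (λ d → d) , λ d → d

  sameDom-sym : ∀ {y z} → SameDom y z → SameDom z y
  sameDom-sym p E = proj₂ (p E) , proj₁ (p E)

  sameDom-trans : ∀ {x y z} → SameDom x y → SameDom y z → SameDom x z
  sameDom-trans p q E = (λ d → proj₁ (q E) (proj₁ (p E) d)) , λ d → proj₂ (p E) (proj₂ (q E) d)

  sameDom-σ : ∀ {z} → Inner z → SameDom z (σ z)
  sameDom-σ i E = dom-σ⁻ E i , dom-σ E (proj₂ i)

  -- One direction follows `a`, the other follows `mate a` between the mates of the end nodes.
  sameDom-arc : ∀ a → Avail a → Inner (src a) → Inner (tgt a) → SameDom (src a) (tgt a)
  sameDom-arc a av iy iz {e} E = dom-arc a E av iy iz , λ dom →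
    dom-σ E (proj₂ iy) (subst (Dom e) (tgt-mate a)
      (dom-arc (mate a) E (avail-mate a av)
        (subst Inner (sym (src-mate a)) (σ-inner iz))
        (subst Inner (sym (tgt-mate a)) (σ-inner iy))
        (subst (Dom e) (sym (src-mate a)) (dom-σ⁻ E iz dom))))

  -- Take a trail ending with `e`. Distinct `d` would have to occur before `e` because it dominates
  -- `tgt e`, and `e` before `d` because it dominates `tgt d`; then `e` would occur twice.
  entry-unique : ∀ {d e} → Entry d → Entry e → SameDom (tgt d) (tgt e) → d ≡ e
  entry-unique {d} {e} D E same with d ≟ᴱ e | extend e (avail E) (proj₂ (proj₁ (outer E)))
  ... | yes d≡e | _ = d≡e
  ... | no _ | inj₂ (_ , _ , t , _) = ⊥-elim (proj₂ (outer E) (_ , t))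
  ... | no d≢e | inj₁ (ds , t , _) with ∈-++⁻ ds (proj₁ (same D) (entry-dom D) t)
  ...   | inj₂ (here d≡e) = ⊥-elim (d≢e d≡e)
  ...   | inj₁ d∈ with ∈-∃++ d∈
  ...     | ds₁ , ds₂ , refl = ⊥-elim (contra (∈-++⁻ ds₁ (proj₂ (same E) (entry-dom E)
              (proj₂ (trail-prefix ds₁ (subst (λ l → Trail l (tgt e)) (++-assoc ds₁ (d ∷ ds₂) [ e ]) t))))))
    where
    contra : e ∈ ds₁ ⊎ e ∈ [ d ] → ⊥
    contra (inj₁ e∈)          = proj₂ (proj₂ (regular-++⁻ (ds₁ ++ d ∷ ds₂) (proj₂ t)))
                                  (∈-++⁺ˡ e∈) (here refl) (inj₁ refl)
    contra (inj₂ (here refl)) = d≢e refl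

  step : ∀ a → Avail a → Reachable (src a) →
    Reachable (tgt a) ⊎ (Reachable (σ (tgt a)) × Reachable (σ (src a)))
  step a av (_ , t) with extend a av t
  ... | inj₁ (_ , t₁ , _)      = inj₁ (_ , t₁)
  ... | inj₂ (_ , t₁ , t₂ , _) = inj₂ ((_ , t₁) , (_ , t₂))

  step-outer : ∀ a → Avail a → Outer (src a) → Reachable (tgt a)
  step-outer a av (r , ¬r′) with step a av r
  ... | inj₁ q       = q
  ... | inj₂ (_ , q) = ⊥-elim (¬r′ q)

  -- Classes of nodes and forbidden residual arcs

  data Class : Set where
    near far mid : Class
    comp         : V → Class

  opposite : Class → Class
  opposite near     = far
  opposite far      = near
  opposite mid      = mid
  opposite (comp x) = comp x

  EntryNode : V → Set
  EntryNode x = ∃[ e ] Entry e × tgt e ≡ x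

  -- A relation rather than a function, since reachability is not decided. A component is named by
  -- the head of its entry. Inner nodes equivalent to no such head are counted as `mid`, so it need
  -- not be settled whether there are any.
  data HasClass (v : V) : Class → Set where
    near      : Outer v → HasClass v near
    far       : Outer (σ v) → HasClass v far
    unreached : ¬ Reachable v → ¬ Reachable (σ v) → HasClass v mid
    stray     : Inner v → (∀ x → EntryNode x → ¬ SameDom v x) → HasClass v mid
    comp      : ∀ {x} → Inner v → EntryNode x → SameDom v x → HasClass v (comp x)

  -- This makes the name of a component well defined.
  entryNode-unique : ∀ {x y} → EntryNode x → EntryNode y → SameDom x y → x ≡ y
  entryNode-unique (_ , D , refl) (_ , E , refl) same = cong tgt (entry-unique D E same)

  hasClass-same : ∀ {v w c d} → Inner v → Inner w → SameDom v w →
    HasClass v c → HasClass w d → c ≡ d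
  hasClass-same (r , r′) (q , q′) same = go
    where
    go : ∀ {c d} → HasClass _ c → HasClass _ d → c ≡ d
    go (near (_ , ¬r)) _ = ⊥-elim (¬r r′)
    go {v} (far (_ , ¬r)) _ = ⊥-elim (¬r (subst Reachable (sym (σ-inv _)) r))
    go (unreached ¬r _) _ = ⊥-elim (¬r r)
    go _ (near (_ , ¬q)) = ⊥-elim (¬q q′)
    go _ (far (_ , ¬q)) = ⊥-elim (¬q (subst Reachable (sym (σ-inv _)) q))
    go _ (unreached ¬q _) = ⊥-elim (¬q q)
    go (stray _ _) (stray _ _) = refl
    go (stray _ n) (comp _ en s) = ⊥-elim (n _ en (sameDom-trans same s))
    go (comp _ en s) (stray _ n) = ⊥-elim (n _ en (sameDom-trans (sameDom-sym same) s))
    go (comp _ en s) (comp _ en′ s′) = cong comp (entryNode-unique en en′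
      (sameDom-trans (sameDom-sym s) (sameDom-trans same s′)))

  hasClass-σ : ∀ {v c} → HasClass v c → HasClass (σ v) (opposite c)
  hasClass-σ {v} (near o) = far (subst Outer (sym (σ-inv v)) o)
  hasClass-σ (far o) = near o
  hasClass-σ {v} (unreached p q) = unreached q λ r → p (subst Reachable (σ-inv v) r)
  hasClass-σ (stray i n) = stray (σ-inner i) λ x en s → n x en (sameDom-trans (sameDom-σ i) s)
  hasClass-σ (comp i en s) = comp (σ-inner i) en (sameDom-trans (sameDom-sym (sameDom-σ i)) s)

  -- The ordered pairs of classes that no residual arc joins. Together with their reversals they
  -- cover all cases of nonzero reduced cost.
  data Forbidden : Class → Class → Set where
    near-far  : Forbidden near far
    near-mid  : Forbidden near mid
    mid-far   : Forbidden mid far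
    comp-mid  : ∀ {x} → Forbidden (comp x) mid
    mid-comp  : ∀ {x} → Forbidden mid (comp x)
    comp-comp : ∀ {x y} → x ≢ y → Forbidden (comp x) (comp y)

  forbidden-near : ∀ {a q} → Avail a → HasClass (src a) near → HasClass (tgt a) q → ¬ Forbidden near q
  forbidden-near {a} av (near o) (far (_ , ¬r)) near-far =
    ¬r (subst Reachable (sym (σ-inv _)) (step-outer a av o))
  forbidden-near {a} av (near o) (unreached ¬r _) near-mid = ¬r (step-outer a av o)
  -- The arc `a` is itself an entry, so its head is an entry node equivalent to itself.
  forbidden-near {a} av (near o) (stray i n) near-mid =
    n _ (a , record { avail = av ; outer = o ; inner = i } , refl) sameDom-refl

  forbidden-comp : ∀ {a x q} → Avail a → HasClass (src a) (comp x) → HasClass (tgt a) q →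
    ¬ Forbidden (comp x) q
  forbidden-comp {a} av (comp (r , _) _ _) (unreached ¬q ¬q′) comp-mid with step a av r
  ... | inj₁ q       = ¬q q
  ... | inj₂ (q , _) = ¬q′ q
  forbidden-comp {a} av c@(comp i _ _) d@(stray j _) comp-mid
    with () ← hasClass-same i j (sameDom-arc a av i j) c d
  forbidden-comp {a} av c@(comp i _ _) d@(comp j _ _) (comp-comp x≢y)
    with refl ← hasClass-same i j (sameDom-arc a av i j) c d = x≢y refl

  forbidden : ∀ {a p q} → Avail a → HasClass (src a) p → HasClass (tgt a) q → ¬ Forbidden p q
  forbidden av c d near-far = forbidden-near av c d near-far
  forbidden av c d near-mid = forbidden-near av c d near-mid
  forbidden av c d comp-mid = forbidden-comp av c d comp-mid
  forbidden av c d f@(comp-comp _) = forbidden-comp av c d f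
  -- The mate of an arc from `mid` to `far` leads from `near` to `mid`; likewise below, mates turn
  -- `mid` to `comp` into `comp` to `mid`.
  forbidden {a} av c d mid-far = forbidden-near (avail-mate a av)
    (subst (λ v → HasClass v _) (sym (src-mate a)) (hasClass-σ d))
    (subst (λ v → HasClass v _) (sym (tgt-mate a)) (hasClass-σ c)) near-mid
  forbidden {a} av c d mid-comp = forbidden-comp (avail-mate a av)
    (subst (λ v → HasClass v _) (sym (src-mate a)) (hasClass-σ d))
    (subst (λ v → HasClass v _) (sym (tgt-mate a)) (hasClass-σ c)) comp-mid

  entry-arc : ∀ {a x} → Avail a → HasClass (src a) near → HasClass (tgt a) (comp x) → Entry a
  entry-arc av (near o) (comp i _ _) = record { avail = av ; outer = o ; inner = i }

  entry-arc-unique : ∀ {a b x} → Avail a → HasClass (src a) near → HasClass (tgt a) (comp x) →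
    Avail b → HasClass (src b) near → HasClass (tgt b) (comp x) → a ≡ b
  entry-arc-unique av c d@(comp _ _ s) bv c′ d′@(comp _ _ s′) =
    entry-unique (entry-arc av c d) (entry-arc bv c′ d′) (sameDom-trans s (sameDom-sym s′))

  hasClass-unique : ∀ {v c d} → HasClass v c → HasClass v d → c ≡ d
  hasClass-unique c@(stray i _)  d = hasClass-same i i sameDom-refl c d
  hasClass-unique c@(comp i _ _) d = hasClass-same i i sameDom-refl c d
  hasClass-unique c d@(stray i _)  = hasClass-same i i sameDom-refl c d
  hasClass-unique c d@(comp i _ _) = hasClass-same i i sameDom-refl c d
  hasClass-unique (near _) (near _) = refl
  hasClass-unique (far _)  (far _)  = refl
  hasClass-unique (unreached _ _) (unreached _ _) = refl
  hasClass-unique (near (r , _)) (far (_ , ¬r)) = ⊥-elim (¬r (subst Reachable (sym (σ-inv _)) r))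
  hasClass-unique (near (r , _)) (unreached ¬r _) = ⊥-elim (¬r r)
  hasClass-unique (far (_ , ¬r)) (near (r , _)) = ⊥-elim (¬r (subst Reachable (sym (σ-inv _)) r))
  hasClass-unique (far (r , _)) (unreached _ ¬r) = ⊥-elim (¬r r)
  hasClass-unique (unreached ¬r _) (near (r , _)) = ⊥-elim (¬r r)
  hasClass-unique (unreached _ ¬r) (far (r , _)) = ⊥-elim (¬r r)

  classify : ∀ v → ¬ ¬ ∃ (HasClass v)
  classify v ¬c = ¬¬-excluded-middle λ r? → ¬¬-excluded-middle λ r′? →
    ¬¬-excluded-middle λ x? → ¬c (go r? r′? x?)
    where
    go : Dec (Reachable v) → Dec (Reachable (σ v)) → Dec (∃[ x ] EntryNode x × SameDom v x) →
      ∃ (HasClass v)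
    go (yes r) (yes r′) (yes (x , en , s)) = comp x , comp (r , r′) en s
    go (yes r) (yes r′) (no n) = mid , stray (r , r′) λ x en s → n (x , en , s)
    go (yes r) (no ¬r′) _ = near , near (r , ¬r′)
    go (no ¬r) (yes r′) _ = far , far (r′ , λ r → ¬r (subst Reachable (σ-inv v) r))
    go (no ¬r) (no ¬r′) _ = mid , unreached ¬r ¬r′

-- The residual network

module Residual {n m} (N : SkewSymmetricNetwork n m) (F : Fin m → ℤ)
  (flow : Integral.IsISFlowℤ N F) where
  open SkewSymmetricNetwork N
  open Integral N
  open IsISFlowℤ flow

  -- An arc a with a direction (true: along a) and one of two copies. The copies stand
  -- for residual capacity at least 1 and at least 2: a regular trail adds at most 2 to
  -- the flow on an arc once it is combined with its mate.
  Arc : Set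
  Arc = Fin m × Bool × Bool

  _≟ᴬ_ : (d e : Arc) → Dec (d ≡ e)
  _≟ᴬ_ = ≡-dec _≟_ (≡-dec Bool._≟_ Bool._≟_)

  src tgt : Arc → Fin n
  src (a , true  , _) = tail a
  src (a , false , _) = head a
  tgt (a , true  , _) = head a
  tgt (a , false , _) = tail a

  -- Reversing a residual arc commutes with the symmetry, so the direction is kept.
  mate : Arc → Arc
  mate (a , d , i) = σE a , d , i

  room : Fin m → Bool → ℤ
  room a true  = + u a ℤ.- F a
  room a false = F a

  need : Bool → ℤ
  need false = + 1
  need true  = + 2

  Avail : Arc → Set
  Avail (a , d , i) = need i ℤ.≤ room a d

  room-σ : ∀ a d → room (σE a) d ≡ room a d
  room-σ a true  = cong₂ (λ c f → + c ℤ.- f) (u-symmetric a) (symmetric a)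
  room-σ a false = symmetric a

  0≤room : ∀ a d → 0ℤ ℤ.≤ room a d
  0≤room a true  = ℤ.i≤j⇒0≤j-i (capacity a)
  0≤room a false = nonNegative a

  src-mate : ∀ e → src (mate e) ≡ σV (tgt e)
  src-mate (a , true  , _) = tail-σE a
  src-mate (a , false , _) = head-σE a

  tgt-mate : ∀ e → tgt (mate e) ≡ σV (src e)
  tgt-mate (a , true  , _) = head-σE a
  tgt-mate (a , false , _) = tail-σE a

  open Trails _≟ᴬ_ src tgt σV mate Avail σV-involutive
    (λ (a , d , i) → cong (_, d , i) (σE-involutive a)) src-mate tgt-mate
    (λ (a , d , i) → subst (need i ℤ.≤_) (sym (room-σ a d))) s public

  -- Augmentation along a regular trail and its mate

  sign : Bool → ℤ
  sign true  = 1ℤ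
  sign false = -1ℤ

  unit : Arc → Fin m → ℤ
  unit (b , d , _) a = ⟦ does (b ≟ a) ⟧ ℤ.* sign d

  push : List Arc → Fin m → ℤ
  push []       a = 0ℤ
  push (e ∷ es) a = unit e a ℤ.+ push es a

  -- Counts agreement with the second arc or its mate, with direction and copy kept apart. `push`
  -- merges the copies and signs the directions, which suits net flows; `hit` suits capacity bounds.
  hit : Arc → Arc → ℤ
  hit (b , d , i) (a , d′ , i′) =
    if does (d Bool.≟ d′) ∧ does (i Bool.≟ i′) then ⟦ does (b ≟ a) ⟧ ℤ.+ ⟦ does (b ≟ σE a) ⟧ else 0ℤ

  hits : List Arc → Arc → ℤ
  hits []       x = 0ℤ
  hits (e ∷ es) x = hit e x ℤ.+ hits es x

  hit-clash : ∀ e x → hit e x ≡ 0ℤ ⊎ (hit e x ≡ 1ℤ × Clash e x)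
  hit-clash (b , d , i) (a , d′ , i′) with d Bool.≟ d′ | i Bool.≟ i′
  ... | no _     | _        = inj₁ refl
  ... | yes refl | no _     = inj₁ refl
  ... | yes refl | yes refl with b ≟ a | b ≟ σE a
  ...   | yes refl | yes p    = ⊥-elim (σE-noFixed a (sym p))
  ...   | yes refl | no _     = inj₂ (refl , inj₁ refl)
  ...   | no _     | yes refl = inj₂ (refl , inj₂ refl)
  ...   | no _     | no _     = inj₁ refl

  clash-trans : ∀ {d e x} → Clash d x → Clash e x → Clash d e
  clash-trans p (inj₁ refl) = p
  clash-trans p (inj₂ refl) = clash-mate p

  clash-avail : ∀ {e x} → Clash e x → Avail e → Avail x
  clash-avail (inj₁ refl) av = av
  clash-avail {x = a , d , i} (inj₂ refl) av = subst (need i ℤ.≤_) (room-σ a d) av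

  -- Two members that both clash with `x` clash with each other, which regularity excludes. The
  -- witness is kept because it carries availability.
  regular-hits : ∀ {es} x → Regular es →
    hits es x ≡ 0ℤ ⊎ (hits es x ≡ 1ℤ × ∃[ e ] e ∈ es × Clash e x)
  regular-hits x []      = inj₁ refl
  regular-hits {e ∷ es} x (p ∷ r) with hit-clash e x | regular-hits x r
  ... | inj₁ z       | inj₁ z′ = inj₁ (cong₂ ℤ._+_ z z′)
  ... | inj₁ z       | inj₂ (o , d , d∈ , c) = inj₂ (cong₂ ℤ._+_ z o , d , there d∈ , c)
  ... | inj₂ (o , c) | inj₁ z′ = inj₂ (cong₂ ℤ._+_ o z′ , e , here refl , c)
  ... | inj₂ (o , c) | inj₂ (_ , d , d∈ , c′) = ⊥-elim (All.lookup p d∈ (clash-trans c c′))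

  path-avail : ∀ es {v w e} → Path v es w → e ∈ es → Avail e
  path-avail (_ ∷ _)  (_ , av , _) (here refl) = av
  path-avail (_ ∷ es) (_ , _ , p)  (there e∈)  = path-avail es p e∈

  module Augment (es : List Arc) (trail : Trail es s′) where
    open ≡.≡-Reasoning

    load : Fin m → Bool → ℤ
    load a d = hits es (a , d , false) ℤ.+ hits es (a , d , true)

    0≤load : ∀ a d → 0ℤ ℤ.≤ load a d
    0≤load a d with hits es (a , d , false) | hits es (a , d , true)
                  | regular-hits (a , d , false) (proj₂ trail) | regular-hits (a , d , true) (proj₂ trail)
    ... | _ | _ | inj₁ refl | inj₁ refl = ℤ.+≤+ ℕ.z≤n
    ... | _ | _ | inj₁ refl | inj₂ (refl , _) = ℤ.+≤+ ℕ.z≤n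
    ... | _ | _ | inj₂ (refl , _) | inj₁ refl = ℤ.+≤+ ℕ.z≤n
    ... | _ | _ | inj₂ (refl , _) | inj₂ (refl , _) = ℤ.+≤+ ℕ.z≤n

    -- Each copy contributes at most one. A load of two involves the second copy, whose availability
    -- means room for two units.
    load≤room : ∀ a d → load a d ℤ.≤ room a d
    load≤room a d with hits es (a , d , false) | hits es (a , d , true)
                  | regular-hits (a , d , false) (proj₂ trail) | regular-hits (a , d , true) (proj₂ trail)
    ... | _ | _ | inj₁ refl | inj₁ refl = 0≤room a d
    ... | _ | _ | inj₂ (refl , e , e∈ , c) | inj₁ refl = clash-avail c (path-avail es (proj₁ trail) e∈)
    ... | _ | _ | inj₁ refl | inj₂ (refl , e , e∈ , c) =
      ℤ.≤-trans (ℤ.+≤+ (ℕ.s≤s ℕ.z≤n)) (clash-avail c (path-avail es (proj₁ trail) e∈))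
    ... | _ | _ | inj₂ (refl , _) | inj₂ (refl , e , e∈ , c) =
      clash-avail c (path-avail es (proj₁ trail) e∈)

    hits-push : ∀ es a → push es a ℤ.+ push es (σE a) ≡
      (hits es (a , true , false) ℤ.+ hits es (a , true , true)) ℤ.-
      (hits es (a , false , false) ℤ.+ hits es (a , false , true))
    hits-push [] a = refl
    hits-push (e ∷ es) a = begin
      (unit e a ℤ.+ push es a) ℤ.+ (unit e (σE a) ℤ.+ push es (σE a))
        ≡⟨ ring₁ (unit e a) (push es a) (unit e (σE a)) (push es (σE a)) ⟩
      (unit e a ℤ.+ unit e (σE a)) ℤ.+ (push es a ℤ.+ push es (σE a))
        ≡⟨ cong₂ ℤ._+_ (hit-unit e) (hits-push es a) ⟩
      ((hit e (a , true , false) ℤ.+ hit e (a , true , true)) ℤ.-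
        (hit e (a , false , false) ℤ.+ hit e (a , false , true))) ℤ.+
      ((hits es (a , true , false) ℤ.+ hits es (a , true , true)) ℤ.-
        (hits es (a , false , false) ℤ.+ hits es (a , false , true)))
        ≡⟨ ring₂ (hit e (a , true , false)) (hit e (a , true , true)) (hit e (a , false , false)) (hit e (a , false , true))
             (hits es (a , true , false)) (hits es (a , true , true)) (hits es (a , false , false)) (hits es (a , false , true)) ⟩
      _ ∎
      where
      ring₁ : ∀ p q r t → (p ℤ.+ q) ℤ.+ (r ℤ.+ t) ≡ (p ℤ.+ r) ℤ.+ (q ℤ.+ t)
      ring₁ = ℤ-Solver.solve-∀
      ring₂ : ∀ p q r t p′ q′ r′ t′ →
        ((p ℤ.+ q) ℤ.- (r ℤ.+ t)) ℤ.+ ((p′ ℤ.+ q′) ℤ.- (r′ ℤ.+ t′)) ≡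
        ((p ℤ.+ p′) ℤ.+ (q ℤ.+ q′)) ℤ.- ((r ℤ.+ r′) ℤ.+ (t ℤ.+ t′))
      ring₂ = ℤ-Solver.solve-∀
      ring⁺₁ : ∀ x y → x ℤ.* 1ℤ ℤ.+ y ℤ.* 1ℤ ≡ ((x ℤ.+ y) ℤ.+ 0ℤ) ℤ.- (0ℤ ℤ.+ 0ℤ)
      ring⁺₁ = ℤ-Solver.solve-∀
      ring⁺₂ : ∀ x y → x ℤ.* 1ℤ ℤ.+ y ℤ.* 1ℤ ≡ (0ℤ ℤ.+ (x ℤ.+ y)) ℤ.- (0ℤ ℤ.+ 0ℤ)
      ring⁺₂ = ℤ-Solver.solve-∀
      ring⁻₁ : ∀ x y → x ℤ.* -1ℤ ℤ.+ y ℤ.* -1ℤ ≡ (0ℤ ℤ.+ 0ℤ) ℤ.- ((x ℤ.+ y) ℤ.+ 0ℤ)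
      ring⁻₁ = ℤ-Solver.solve-∀
      ring⁻₂ : ∀ x y → x ℤ.* -1ℤ ℤ.+ y ℤ.* -1ℤ ≡ (0ℤ ℤ.+ 0ℤ) ℤ.- (0ℤ ℤ.+ (x ℤ.+ y))
      ring⁻₂ = ℤ-Solver.solve-∀
      hit-unit : ∀ e → unit e a ℤ.+ unit e (σE a) ≡
        (hit e (a , true , false) ℤ.+ hit e (a , true , true)) ℤ.-
        (hit e (a , false , false) ℤ.+ hit e (a , false , true))
      hit-unit (b , true  , false) = ring⁺₁ ⟦ does (b ≟ a) ⟧ ⟦ does (b ≟ σE a) ⟧
      hit-unit (b , true  , true)  = ring⁺₂ ⟦ does (b ≟ a) ⟧ ⟦ does (b ≟ σE a) ⟧
      hit-unit (b , false , false) = ring⁻₁ ⟦ does (b ≟ a) ⟧ ⟦ does (b ≟ σE a) ⟧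
      hit-unit (b , false , true)  = ring⁻₂ ⟦ does (b ≟ a) ⟧ ⟦ does (b ≟ σE a) ⟧

    net-+ : ∀ f g v → netF (λ a → f a ℤ.+ g a) v ≡ netF f v ℤ.+ netF g v
    net-+ f g v = trans (cong₂ ℤ._-_ (split tail) (split head))
      (ring (part tail f) (part tail g) (part head f) (part head g))
      where
      part : (Fin m → Fin n) → (Fin m → ℤ) → ℤ
      part end f = sumℤ λ a → ⟦ does (end a ≟ v) ⟧ ℤ.* f a
      split : ∀ end → part end (λ a → f a ℤ.+ g a) ≡ part end f ℤ.+ part end g
      split end = trans (Sumℤ.sum-cong-≗ λ a → ℤ.*-distribˡ-+ ⟦ does (end a ≟ v) ⟧ (f a) (g a))
        (Sumℤ.∑-distrib-+ (λ a → ⟦ does (end a ≟ v) ⟧ ℤ.* f a) _)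
      ring : ∀ p q r t → (p ℤ.+ q) ℤ.- (r ℤ.+ t) ≡ (p ℤ.- r) ℤ.+ (q ℤ.- t)
      ring = ℤ-Solver.solve-∀

    at : Fin n → Fin n → ℤ
    at w v = ⟦ does (w ≟ v) ⟧

    net-unit : ∀ e v → netF (unit e) v ≡ at (src e) v ℤ.- at (tgt e) v
    net-unit (b , d , i) v = trans (cong₂ ℤ._-_ (end-unit tail) (end-unit head)) (orient d)
      where
      end-unit : ∀ (end : Fin m → Fin n) →
        sumℤ (λ a → ⟦ does (end a ≟ v) ⟧ ℤ.* unit (b , d , i) a) ≡ at (end b) v ℤ.* sign d
      end-unit end = trans (Sumℤ.sum-cong-≗ λ a → swap (at (end a) v) ⟦ does (b ≟ a) ⟧ (sign d))
        (Sumℤ.sum-select b (λ a → at (end a) v ℤ.* sign d))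
        where
        swap : ∀ x y z → x ℤ.* (y ℤ.* z) ≡ y ℤ.* (x ℤ.* z)
        swap = ℤ-Solver.solve-∀
      orient : ∀ d → at (tail b) v ℤ.* sign d ℤ.- at (head b) v ℤ.* sign d ≡
        at (src (b , d , i)) v ℤ.- at (tgt (b , d , i)) v
      orient true  = ring (at (tail b) v) (at (head b) v)
        where
        ring : ∀ x y → x ℤ.* 1ℤ ℤ.- y ℤ.* 1ℤ ≡ x ℤ.- y
        ring = ℤ-Solver.solve-∀
      orient false = ring (at (tail b) v) (at (head b) v)
        where
        ring : ∀ x y → x ℤ.* -1ℤ ℤ.- y ℤ.* -1ℤ ≡ y ℤ.- x
        ring = ℤ-Solver.solve-∀

    net-push : ∀ es {x y} v → Path x es y → netF (push es) v ≡ at x v ℤ.- at y v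
    net-push [] {x} v refl = begin
      netF (λ _ → 0ℤ) v ≡⟨ cong₂ ℤ._-_ (zeros tail) (zeros head) ⟩
      0ℤ ℤ.- 0ℤ         ≡⟨ ℤ.+-inverseʳ (at x v) ⟨
      at x v ℤ.- at x v ∎
      where
      zeros : ∀ (end : Fin m → Fin n) → sumℤ (λ a → ⟦ does (end a ≟ v) ⟧ ℤ.* 0ℤ) ≡ 0ℤ
      zeros end = trans (Sumℤ.sum-cong-≗ λ a → ℤ.*-zeroʳ ⟦ does (end a ≟ v) ⟧) (sumℤ-zero m)
    net-push (e ∷ es) {_} {y} v (refl , _ , p) = begin
      netF (push (e ∷ es)) v                   ≡⟨ net-+ (unit e) (push es) v ⟩
      netF (unit e) v ℤ.+ netF (push es) v     ≡⟨ cong₂ ℤ._+_ (net-unit e v) (net-push es v p) ⟩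
      (at (src e) v ℤ.- at (tgt e) v) ℤ.+ (at (tgt e) v ℤ.- at y v) ≡⟨ ring (at (src e) v) (at (tgt e) v) (at y v) ⟩
      at (src e) v ℤ.- at y v                  ∎
      where
      ring : ∀ x y z → (x ℤ.- y) ℤ.+ (y ℤ.- z) ≡ x ℤ.- z
      ring = ℤ-Solver.solve-∀

    σV-adjoint : ∀ w v → does (σV w ≟ v) ≡ does (w ≟ σV v)
    σV-adjoint w v = does-⇔ (mk⇔ (λ p → trans (sym (σV-involutive w)) (cong σV p))
      (λ p → trans (cong σV p) (σV-involutive v))) (σV w ≟ v) (w ≟ σV v)

    -- Reindexing by `σE` exchanges tails and heads, hence the sign.
    net-σ : ∀ f v → netF (f ∘ σE) v ≡ ℤ.- netF f (σV v)
    net-σ f v = trans (cong₂ ℤ._-_ (flip tail head tail-σE) (flip head tail head-σE))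
      (ring (sumℤ λ a → at (head a) (σV v) ℤ.* f a) (sumℤ λ a → at (tail a) (σV v) ℤ.* f a))
      where
      flip : ∀ (end end′ : Fin m → Fin n) → (∀ a → end (σE a) ≡ σV (end′ a)) →
        sumℤ (λ a → at (end a) v ℤ.* f (σE a)) ≡ sumℤ (λ a → at (end′ a) (σV v) ℤ.* f a)
      flip end end′ eq = trans
        (Sumℤ.sum-cong-≗ λ a → cong (λ b → ⟦ b ⟧ ℤ.* f (σE a)) (begin
          does (end a ≟ v)              ≡⟨ cong (λ x → does (end x ≟ v)) (σE-involutive a) ⟨
          does (end (σE (σE a)) ≟ v)    ≡⟨ cong (λ x → does (x ≟ v)) (eq (σE a)) ⟩
          does (σV (end′ (σE a)) ≟ v)   ≡⟨ σV-adjoint (end′ (σE a)) v ⟩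
          does (end′ (σE a) ≟ σV v)     ∎))
        (sumℤ-involution σE σE-involutive λ a → at (end′ a) (σV v) ℤ.* f a)
      ring : ∀ x y → x ℤ.- y ≡ ℤ.- (y ℤ.- x)
      ring = ℤ-Solver.solve-∀

    F⁺ : Fin m → ℤ
    F⁺ a = F a ℤ.+ (push es a ℤ.+ push es (σE a))

    net-F⁺ : ∀ v → netF F⁺ v ≡ netF F v ℤ.+ + 2 ℤ.* (at s v ℤ.- at s′ v)
    net-F⁺ v = begin
      netF F⁺ v ≡⟨ net-+ F _ v ⟩
      netF F v ℤ.+ netF (λ a → push es a ℤ.+ push es (σE a)) v
        ≡⟨ cong (ℤ._+_ (netF F v)) (net-+ (push es) (push es ∘ σE) v) ⟩
      netF F v ℤ.+ (netF (push es) v ℤ.+ netF (push es ∘ σE) v)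
        ≡⟨ cong (ℤ._+_ (netF F v)) (cong₂ ℤ._+_ (net-push es v (proj₁ trail))
             (trans (net-σ (push es) v) (cong ℤ.-_ (trans (net-push es (σV v) (proj₁ trail)) back)))) ⟩
      netF F v ℤ.+ ((at s v ℤ.- at s′ v) ℤ.+ ℤ.- (at s′ v ℤ.- at s v))
        ≡⟨ cong (ℤ._+_ (netF F v)) (ring (at s v) (at s′ v)) ⟩
      netF F v ℤ.+ + 2 ℤ.* (at s v ℤ.- at s′ v) ∎
      where
      back : at s (σV v) ℤ.- at s′ (σV v) ≡ at s′ v ℤ.- at s v
      back = cong₂ (λ b c → ⟦ b ⟧ ℤ.- ⟦ c ⟧) (sym (σV-adjoint s v))
        (trans (sym (σV-adjoint s′ v)) (cong (λ w → does (w ≟ v)) (σV-involutive s)))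
      ring : ∀ x y → (x ℤ.- y) ℤ.+ ℤ.- (y ℤ.- x) ≡ + 2 ℤ.* (x ℤ.- y)
      ring = ℤ-Solver.solve-∀

    F⁺-load : ∀ a → F⁺ a ≡ F a ℤ.+ (load a true ℤ.- load a false)
    F⁺-load a = cong (ℤ._+_ (F a)) (hits-push es a)

    F⁺-isISFlow : IsISFlowℤ F⁺
    F⁺-isISFlow = record
      { nonNegative = λ a → subst (0ℤ ℤ.≤_) (sym (trans (F⁺-load a) (ring₁ (F a) (load a true) (load a false))))
          (ℤ.+-mono-≤ (0≤load a true) (ℤ.i≤j⇒0≤j-i (load≤room a false)))
      ; capacity = λ a → subst₂ ℤ._≤_ (sym (trans (F⁺-load a) (ring₂ (F a) (load a true) (load a false)))) (ring₃ (F a) (+ u a))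
          (ℤ.+-mono-≤ (ℤ.+-monoʳ-≤ (F a) (load≤room a true)) (ℤ.neg-mono-≤ (0≤load a false)))
      ; conservation = λ v v≢s v≢s′ → trans (net-F⁺ v) (trans
          (cong₂ (λ b c → netF F v ℤ.+ + 2 ℤ.* (⟦ b ⟧ ℤ.- ⟦ c ⟧))
            (dec-false (s ≟ v) (v≢s ∘ sym)) (dec-false (s′ ≟ v) (v≢s′ ∘ sym)))
          (trans (ℤ.+-identityʳ (netF F v)) (conservation v v≢s v≢s′)))
      ; symmetric = λ a → cong₂ ℤ._+_ (symmetric a)
          (trans (ℤ.+-comm (push es (σE a)) _) (cong (λ b → push es b ℤ.+ push es (σE a)) (σE-involutive a)))
      }
      where
      ring₁ : ∀ f p q → f ℤ.+ (p ℤ.- q) ≡ p ℤ.+ (f ℤ.- q)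
      ring₁ = ℤ-Solver.solve-∀
      ring₂ : ∀ f p q → f ℤ.+ (p ℤ.- q) ≡ (f ℤ.+ p) ℤ.+ ℤ.- q
      ring₂ = ℤ-Solver.solve-∀
      ring₃ : ∀ f c → (f ℤ.+ (c ℤ.- f)) ℤ.+ ℤ.- 0ℤ ≡ c
      ring₃ = ℤ-Solver.solve-∀

    F⁺-value : netF F s ℤ.< netF F⁺ s
    F⁺-value = subst₂ ℤ._<_ (ℤ.+-identityʳ (netF F s))
      (sym (trans (net-F⁺ s) (cong₂ (λ b c → netF F s ℤ.+ + 2 ℤ.* (⟦ b ⟧ ℤ.- ⟦ c ⟧))
        (dec-true (s ≟ s) refl) (dec-false (s′ ≟ s) (σV-noFixed s)))))
      (ℤ.+-monoʳ-< (netF F s) (ℤ.+<+ (ℕ.s≤s ℕ.z≤n)))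

-- Tightness of the component fragments

module Barrier {n m} (N : SkewSymmetricNetwork n m) (F : Fin m → ℤ)
  (flow : Integral.IsISFlowℤ N F) where
  open SkewSymmetricNetwork N
  open Integral N
  open IsISFlowℤ flow
  open Residual N F flow

  forbidden-room : ∀ {a d p q} → HasClass (src (a , d , false)) p → HasClass (tgt (a , d , false)) q →
    Forbidden p q → room a d ≡ 0ℤ
  forbidden-room {a} {d} c c′ f = ℤ.≤-antisym
    (ℤ.≮⇒≥ λ 0<r → forbidden {a , d , false} (ℤ.i<j⇒suc[i]≤j 0<r) c c′ f) (0≤room a d)

  is : Class → Fin n → Bool
  is (comp y) x = does (y ≟ x)
  is _        x = false

  isNear : Class → Bool
  isNear near = true
  isNear _    = false

  is-opposite : ∀ p x → is (opposite p) x ≡ is p x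
  is-opposite near     x = refl
  is-opposite far      x = refl
  is-opposite mid      x = refl
  is-opposite (comp _) x = refl

  is⇒≡ : ∀ p {x} → is p x ≡ true → p ≡ comp x
  is⇒≡ (comp y) {x} eq with yes y≡x ← y ≟ x = cong comp y≡x

  is-comp : ∀ x → is (comp x) x ≡ true
  is-comp x = dec-true (x ≟ x) refl

  module Labelled (label : Fin n → Class) (hasClass : ∀ v → HasClass v (label v)) where

    label-σ : ∀ v → label (σV v) ≡ opposite (label v)
    label-σ v = hasClass-unique (hasClass (σV v)) (hasClass-σ (hasClass v))

    full : ∀ a → Forbidden (label (tail a)) (label (head a)) → F a ≡ + u a
    full a f = sym (ℤ.i-j≡0⇒i≡j (+ u a) (F a) (forbidden-room {a} {true} (hasClass (tail a)) (hasClass (head a)) f))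

    void : ∀ a → Forbidden (label (head a)) (label (tail a)) → F a ≡ 0ℤ
    void a = forbidden-room {a} {false} (hasClass (head a)) (hasClass (tail a))

    nodesOf : Fin n → Fin n → Bool
    nodesOf x v = is (label v) x

    -- The set of arcs that plays the part of `U` in the fragment of the component `x`. `F` fills
    -- these arcs, except that one unit is left on one of them when the entry is a forward arc.
    arcsOf : Fin n → Fin m → Bool
    arcsOf x a = isNear (label (tail a)) ∧ is (label (head a)) x

    nodesOf-σ : ∀ x v → nodesOf x (σV v) ≡ nodesOf x v
    nodesOf-σ x v = trans (cong (λ p → is p x) (label-σ v)) (is-opposite (label v) x)

    module Component (s-near : label s ≡ near) (x : Fin n) where

      open Fragment F flow (nodesOf x) (nodesOf-σ x) (cong (λ p → is p x) s-near) public

      first-copy : ∀ {a d} i → Avail (a , d , i) → Avail (a , d , false)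
      first-copy false av = av
      first-copy true  av = ℤ.≤-trans (ℤ.+≤+ (ℕ.s≤s ℕ.z≤n)) av

      src-copy : ∀ a d → src (a , d , false) ≡ src (a , d , true)
      src-copy a true  = refl
      src-copy a false = refl

      tgt-copy : ∀ a d → tgt (a , d , false) ≡ tgt (a , d , true)
      tgt-copy a true  = refl
      tgt-copy a false = refl

      module _ (b : Fin m) (d i : Bool) (entry : Entry (b , d , i)) (tgt≡x : tgt (b , d , i) ≡ x) where

        near-entry : HasClass (src (b , d , i)) near
        near-entry = near (outer entry)

        comp-entry : HasClass (tgt (b , d , i)) (comp x)
        comp-entry = comp (inner entry) (_ , entry , tgt≡x)
          (subst (SameDom (tgt (b , d , i))) tgt≡x sameDom-refl)

        -- With room for two units, both copies of the arc would be entries to the same component,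
        -- against uniqueness. So the entry has room exactly one, and every other candidate has room
        -- zero.
        entry-room : ∀ a d′ → HasClass (src (a , d′ , false)) near → HasClass (tgt (a , d′ , false)) (comp x) →
          (room a d′ ≡ 1ℤ × (a , d′) ≡ (b , d)) ⊎ (room a d′ ≡ 0ℤ × (a , d′) ≢ (b , d))
        entry-room a d′ c c′ with 1ℤ ℤ.≤? room a d′ | + 2 ℤ.≤? room a d′
        ... | no r≱1 | _ = inj₂ (ℤ.≤-antisym (ℤ.≮⇒≥ λ 0<r → r≱1 (ℤ.i<j⇒suc[i]≤j 0<r)) (0≤room a d′) ,
              λ { refl → r≱1 (first-copy {b} {d} i (avail entry)) })
        ... | yes 1≤r | no r≱2 = inj₁ (ℤ.≤-antisym (ℤ.≮⇒≥ λ 1<r → r≱2 (ℤ.i<j⇒suc[i]≤j 1<r)) 1≤r ,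
              cong (λ e → proj₁ e , proj₁ (proj₂ e))
                (entry-arc-unique {a , d′ , false} {b , d , i} 1≤r c c′ (avail entry) near-entry comp-entry))
        ... | yes 1≤r | yes 2≤r
          with () ← entry-arc-unique {a , d′ , false} {a , d′ , true} 1≤r c c′ 2≤r
            (subst (λ v → HasClass v near) (src-copy a d′) c)
            (subst (λ v → HasClass v (comp x)) (tgt-copy a d′) c′)

        -- The arc of the network entering the component whose slack is the room of the entry.
        entered : Bool → Fin m
        entered true  = b
        entered false = σE b

        tailClass : Bool → Class
        tailClass true  = near
        tailClass false = far

        label-src : label (src (b , d , i)) ≡ near
        label-src = hasClass-unique (hasClass _) near-entry

        label-tgt : label (tgt (b , d , i)) ≡ comp x
        label-tgt = hasClass-unique (hasClass _) comp-entry

        label-tail : ∀ d → label (src (b , d , i)) ≡ near → label (tail (entered d)) ≡ tailClass d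
        label-tail true  eq = eq
        label-tail false eq = trans (cong label (tail-σE b)) (trans (label-σ (head b)) (cong opposite eq))

        label-head : ∀ d → label (tgt (b , d , i)) ≡ comp x → label (head (entered d)) ≡ comp x
        label-head true  eq = eq
        label-head false eq = trans (cong label (head-σE b)) (trans (label-σ (tail b)) (cong opposite eq))

        -- The summand `slack` with the labels of the ends, the capacity and the flow abstracted, so
        -- that it can be evaluated class by class.
        slackOf : Class → Class → ℤ → ℤ → ℤ
        slackOf p q c f = ⟦ isNear p ∧ is q x ⟧ ℤ.* (c ℤ.- f) ℤ.+
          (⟦ is q x ⟧ ℤ.* (1ℤ ℤ.- ⟦ is p x ⟧) ℤ.- ⟦ isNear p ∧ is q x ⟧) ℤ.* f

        slackOf-outside : ∀ p q c f → is q x ≡ false → slackOf p q c f ≡ 0ℤ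
        slackOf-outside p q c f eq rewrite eq | Bool.∧-zeroʳ (isNear p) = refl

        slackOf-inner : ∀ c f → slackOf (comp x) (comp x) c f ≡ 0ℤ
        slackOf-inner c f rewrite is-comp x = refl

        slackOf-void : ∀ p c → isNear p ≡ false → slackOf p (comp x) c 0ℤ ≡ 0ℤ
        slackOf-void p c eq rewrite eq = trans (ℤ.+-identityˡ _) (ℤ.*-zeroʳ (⟦ is (comp x) x ⟧ ℤ.* (1ℤ ℤ.- ⟦ is p x ⟧) ℤ.- 0ℤ))

        slackOf-near : ∀ c f → slackOf near (comp x) c f ≡ c ℤ.- f
        slackOf-near c f rewrite is-comp x = ring c f
          where
          ring : ∀ c f → 1ℤ ℤ.* (c ℤ.- f) ℤ.+ 0ℤ ℤ.* f ≡ c ℤ.- f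
          ring = ℤ-Solver.solve-∀

        slackOf-far : ∀ c f → slackOf far (comp x) c f ≡ f
        slackOf-far c f rewrite is-comp x = ring f
          where
          ring : ∀ f → 0ℤ ℤ.+ 1ℤ ℤ.* f ≡ f
          ring = ℤ-Solver.solve-∀

        not-entered : ∀ {a z} → z ≡ 0ℤ → entered d ≢ a → z ≡ ⟦ does (entered d ≟ a) ⟧
        not-entered {a} z≡0 ≢a = trans z≡0 (cong ⟦_⟧ (sym (dec-false (entered d ≟ a) ≢a)))

        is-entered : ∀ {a z} → z ≡ 1ℤ → entered d ≡ a → z ≡ ⟦ does (entered d ≟ a) ⟧
        is-entered {a} z≡1 ≡a = trans z≡1 (cong ⟦_⟧ (sym (dec-true (entered d ≟ a) ≡a)))

        -- Arcs into the component from `mid` or from another component carry no flow, since their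
        -- reversals are forbidden. Those from `near` and `far` are governed by `entry-room`, which
        -- leaves a single unit of slack.
        slack-case : ∀ a p q → label (tail a) ≡ p → label (head a) ≡ q →
          slackOf p q (+ u a) (F a) ≡ ⟦ does (entered d ≟ a) ⟧
        slack-case a p q eqp eqq = go (is q x) refl
          where
          tail≢ : (∀ d → p ≢ tailClass d) → entered d ≢ a
          tail≢ h refl = h d (trans (sym eqp) (label-tail d label-src))
          at-near : p ≡ near → entered d ≡ a → (a , true) ≡ (b , d)
          at-near refl refl = match d (trans (sym eqp) (label-tail d label-src))
            where
            match : ∀ d → near ≡ tailClass d → (entered d , true) ≡ (b , d)
            match true _ = refl
          at-far : p ≡ far → entered d ≡ a → (σE a , false) ≡ (b , d)
          at-far refl refl = match d (trans (sym eqp) (label-tail d label-src))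
            where
            match : ∀ d → far ≡ tailClass d → (σE (entered d) , false) ≡ (b , d)
            match false _ = cong (_, false) (σE-involutive b)
          from : ∀ {a} d → (a , true) ≡ (b , d) → entered d ≡ a
          from true refl = refl
          from′ : ∀ {a} d → (σE a , false) ≡ (b , d) → entered d ≡ a
          from′ {a} false refl = σE-involutive a
          go : ∀ b → is q x ≡ b → slackOf p q (+ u a) (F a) ≡ ⟦ does (entered d ≟ a) ⟧
          go false eq = not-entered (slackOf-outside p q (+ u a) (F a) eq) λ { refl → contra
            (trans (sym (is-comp x)) (trans (cong (λ r → is r x) (trans (sym (label-head d label-tgt)) eqq)) eq)) }
            where
            contra : true ≢ false
            contra ()
          go true eq with refl ← is⇒≡ q eq = at-comp p eqp refl
            where
            at-comp : ∀ r → label (tail a) ≡ r → p ≡ r → slackOf r (comp x) (+ u a) (F a) ≡ ⟦ does (entered d ≟ a) ⟧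
            at-comp near e refl = choose (entry-room a true
              (subst (HasClass _) e (hasClass _)) (subst (HasClass _) eqq (hasClass _)))
              where
              choose : (room a true ≡ 1ℤ × (a , true) ≡ (b , d)) ⊎ (room a true ≡ 0ℤ × (a , true) ≢ (b , d)) →
                slackOf near (comp x) (+ u a) (F a) ≡ ⟦ does (entered d ≟ a) ⟧
              choose (inj₁ (r , eq)) = is-entered (trans (slackOf-near (+ u a) (F a)) r) (from d eq)
              choose (inj₂ (r , ≢)) = not-entered (trans (slackOf-near (+ u a) (F a)) r) λ e → ≢ (at-near refl e)
            -- Read backwards, the mate of `a` leads from `near` into the component, and its room is
            -- the flow on `a`.
            at-comp far e refl = choose (entry-room (σE a) false
              (subst (λ v → HasClass v near) (sym (head-σE a)) (hasClass-σ (subst (HasClass _) e (hasClass _))))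
              (subst (λ v → HasClass v (comp x)) (sym (tail-σE a)) (hasClass-σ (subst (HasClass _) eqq (hasClass _)))))
              where
              choose : (room (σE a) false ≡ 1ℤ × (σE a , false) ≡ (b , d)) ⊎
                       (room (σE a) false ≡ 0ℤ × (σE a , false) ≢ (b , d)) →
                slackOf far (comp x) (+ u a) (F a) ≡ ⟦ does (entered d ≟ a) ⟧
              choose (inj₁ (r , eq)) = is-entered (trans (slackOf-far (+ u a) (F a)) (trans (sym (symmetric a)) r)) (from′ d eq)
              choose (inj₂ (r , ≢)) = not-entered (trans (slackOf-far (+ u a) (F a)) (trans (sym (symmetric a)) r)) λ e → ≢ (at-far refl e)
            at-comp mid e refl = not-entered
              (trans (cong (slackOf mid (comp x) (+ u a)) (void a (subst₂ Forbidden (sym eqq) (sym e) comp-mid)))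
                (slackOf-void mid (+ u a) refl))
              (tail≢ λ { true () ; false () })
            at-comp (comp y) e refl = at-y (y ≟ x)
              where
              at-y : Dec (y ≡ x) → slackOf (comp y) (comp x) (+ u a) (F a) ≡ ⟦ does (entered d ≟ a) ⟧
              at-y (yes refl) = not-entered (slackOf-inner (+ u a) (F a)) (tail≢ λ { true () ; false () })
              at-y (no y≢x) = not-entered
                (trans (cong (slackOf (comp y) (comp x) (+ u a))
                    (void a (subst₂ Forbidden (sym eqq) (sym e) (comp-comp (y≢x ∘ sym)))))
                  (slackOf-void (comp y) (+ u a) refl))
                (tail≢ λ { true () ; false () })

        slack-entry : sumℤ (slack (arcsOf x)) ≡ 1ℤ
        slack-entry = trans (Sumℤ.sum-cong-≗ λ a → trans (slack-case a _ _ refl refl) (sym (ℤ.*-identityʳ _)))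
          (Sumℤ.sum-select (entered d) (λ _ → 1ℤ))

      slack≡1 : ∀ v → label v ≡ comp x → sumℤ (slack (arcsOf x)) ≡ 1ℤ
      slack≡1 v eq with comp _ ((b , d , i) , entry , tgt≡x) _ ← subst (HasClass v) eq (hasClass v) =
        slack-entry b d i entry tgt≡x

-- Potentials, multipliers and reduced costs

module Dual {n m} (N : SkewSymmetricNetwork n m) (F : Fin m → ℤ)
  (flow : Integral.IsISFlowℤ N F) where
  open SkewSymmetricNetwork N
  open Integral N
  open IsISFlowℤ flow
  open Residual N F flow
  open Barrier N F flow

  level : Class → ℤ
  level near     = + 2
  level far      = 0ℤ
  level mid      = 1ℤ
  level (comp _) = 1ℤ

  -- The value of `χ⁺` for the component `x` on an arc that leads from class `p` into it: 1 from
  -- `near`, 0 from `x` itself, -1 otherwise.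
  β : Class → Fin n → ℤ
  β p x = + 2 ℤ.* ⟦ isNear p ⟧ ℤ.- 1ℤ ℤ.+ ⟦ is p x ⟧

  totalβ : Class → Class → ℤ
  totalβ p (comp x) = β p x
  totalβ p _        = 0ℤ

  -- The second `totalβ` is the share of the mate, which leads from `opposite q` to `opposite p`.
  reducedCost : Class → Class → ℤ
  reducedCost p q = level p ℤ.- level q ℤ.- (totalβ p q ℤ.+ totalβ (opposite q) (opposite p))

  -- Complementary slackness by classes: a forbidden forward residual arc means a full arc, a
  -- forbidden backward one an empty arc.
  data Slackness (p q : Class) (c : ℤ) : Set where
    zero     : c ≡ 0ℤ → Slackness p q c
    positive : 0ℤ ℤ.≤ c → Forbidden p q → Slackness p q c
    negative : c ℤ.≤ 0ℤ → Forbidden q p → Slackness p q c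

  slackness : ∀ p q → Slackness p q (reducedCost p q)
  slackness near near = zero refl
  slackness near far  = positive (ℤ.+≤+ ℕ.z≤n) near-far
  slackness near mid  = positive (ℤ.+≤+ ℕ.z≤n) near-mid
  slackness near (comp _) = zero refl
  slackness far near = negative ℤ.-≤+ near-far
  slackness far far  = zero refl
  slackness far mid  = negative ℤ.-≤+ mid-far
  slackness far (comp _) = zero refl
  slackness mid near = negative ℤ.-≤+ near-mid
  slackness mid far  = positive (ℤ.+≤+ ℕ.z≤n) mid-far
  slackness mid mid  = zero refl
  slackness mid (comp _) = positive (ℤ.+≤+ ℕ.z≤n) mid-comp
  slackness (comp _) near = zero refl
  slackness (comp _) far  = zero refl
  slackness (comp _) mid  = positive (ℤ.+≤+ ℕ.z≤n) comp-mid
  slackness (comp x) (comp y) with x ≟ y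
  ... | yes refl rewrite is-comp x = zero refl
  ... | no x≢y rewrite dec-false (y ≟ x) (x≢y ∘ sym) = positive (ℤ.+≤+ ℕ.z≤n) (comp-comp x≢y)

  module Weights (label : Fin n → Class) (hasClass : ∀ v → HasClass v (label v)) (s-near : label s ≡ near) where

    open Labelled label hasClass

    -- Every node `x` receives multiplier one, so that the sum can run over all of `Fin n`; when `x`
    -- names no component, the weight vanishes by `weight-empty`.
    weight : Fin n → Fin m → ℤ
    weight x = χ± (arcsOf x)
      where open Component s-near x

    cost : Fin m → ℤ
    cost a = reducedCost (label (tail a)) (label (head a))

    sum-β : ∀ p q → sumℤ (λ x → ⟦ is q x ⟧ ℤ.* β p x) ≡ totalβ p q
    sum-β p near     = sumℤ-zero n
    sum-β p far      = sumℤ-zero n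
    sum-β p mid      = sumℤ-zero n
    sum-β p (comp y) = Sumℤ.sum-select y (β p)

    weight-β : ∀ x a → weight x a ≡ ⟦ is (label (head a)) x ⟧ ℤ.* β (label (tail a)) x ℤ.+
      ⟦ is (label (head (σE a))) x ⟧ ℤ.* β (label (tail (σE a))) x
    weight-β x a = cong₂ ℤ._+_ (entry-weight a) (entry-weight (σE a))
      where
      open Component s-near x
      bool : ∀ i j k → + 2 ℤ.* ⟦ i ∧ j ⟧ ℤ.- ⟦ j ⟧ ℤ.* (1ℤ ℤ.- ⟦ k ⟧) ≡
        ⟦ j ⟧ ℤ.* (+ 2 ℤ.* ⟦ i ⟧ ℤ.- 1ℤ ℤ.+ ⟦ k ⟧)
      bool true  true  true  = refl
      bool true  true  false = refl
      bool true  false true  = refl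
      bool true  false false = refl
      bool false true  true  = refl
      bool false true  false = refl
      bool false false true  = refl
      bool false false false = refl
      entry-weight : ∀ a → χ⁺ (arcsOf x) a ≡ ⟦ is (label (head a)) x ⟧ ℤ.* β (label (tail a)) x
      entry-weight a = bool (isNear (label (tail a))) (is (label (head a)) x) (is (label (tail a)) x)

    sum-weight : ∀ a → sumℤ (λ x → weight x a) ≡
      totalβ (label (tail a)) (label (head a)) ℤ.+ totalβ (opposite (label (head a))) (opposite (label (tail a)))
    sum-weight a = trans (Sumℤ.sum-cong-≗ λ x → weight-β x a)
      (trans (Sumℤ.∑-distrib-+ (λ x → ⟦ is (label (head a)) x ⟧ ℤ.* β (label (tail a)) x) _)
        (cong₂ ℤ._+_ (sum-β (label (tail a)) (label (head a)))
          (trans (sum-β (label (tail (σE a))) (label (head (σE a))))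
            (cong₂ totalβ (trans (cong label (tail-σE a)) (label-σ (head a)))
                          (trans (cong label (head-σE a)) (label-σ (tail a)))))))

    cost+weights : ∀ a → level (label (tail a)) ℤ.- level (label (head a)) ≡
      cost a ℤ.+ sumℤ (λ x → weight x a)
    cost+weights a = trans (ring (level (label (tail a)) ℤ.- level (label (head a))) _)
      (cong (ℤ._+_ (cost a)) (sym (sum-weight a)))
      where
      ring : ∀ d t → d ≡ d ℤ.- t ℤ.+ t
      ring = ℤ-Solver.solve-∀

    cost-slackness : ∀ a → cost a ≡ 0ℤ ⊎ (0ℤ ℤ.≤ cost a × F a ≡ + u a) ⊎ (cost a ℤ.≤ 0ℤ × F a ≡ 0ℤ)
    cost-slackness a = go (slackness (label (tail a)) (label (head a)))
      where
      go : ∀ {c} → Slackness (label (tail a)) (label (head a)) c →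
        c ≡ 0ℤ ⊎ (0ℤ ℤ.≤ c × F a ≡ + u a) ⊎ (c ℤ.≤ 0ℤ × F a ≡ 0ℤ)
      go (zero e)       = inj₁ e
      go (positive p f) = inj₂ (inj₁ (p , full a f))
      go (negative p f) = inj₂ (inj₂ (p , void a f))

    weight-empty : ∀ x → (∀ v → label v ≢ comp x) → ∀ a → weight x a ≡ 0ℤ
    weight-empty x ∉x a = trans (weight-β x a)
      (cong₂ (λ b c → ⟦ b ⟧ ℤ.* β (label (tail a)) x ℤ.+ ⟦ c ⟧ ℤ.* β (label (tail (σE a))) x)
        (empty (head a)) (empty (head (σE a))))
      where
      empty : ∀ v → is (label v) x ≡ false
      empty v = go (is (label v) x) refl
        where
        go : ∀ b → is (label v) x ≡ b → is (label v) x ≡ false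
        go false eq = eq
        go true  eq = ⊥-elim (∉x v (is⇒≡ (label v) eq))

-- The linear program

≤ℝ-preorder : Preorder 0ℓ 0ℓ 0ℓ
≤ℝ-preorder = record
  { Carrier = ℝ ; _≈_ = _≃_ ; _≲_ = _≤ℝ_
  ; isPreorder = record
    { isEquivalence = record
      { refl  = λ {x} → ≃-pointwise {x} {x} λ _ → refl
      ; sym   = λ {x} {y} → ≃-sym {x} {y}
      ; trans = λ {x} {y} {z} → ≃-trans {x} {y} {z}
      }
    ; reflexive = λ {x} {y} → ≃⇒≤ {x} {y}
    ; trans = λ {x} {y} {z} → ≤ℝ-trans {x} {y} {z}
    }
  }

module ≤ℝ-Reasoning where
  open import Relation.Binary.Reasoning.Preorder ≤ℝ-preorder public

does-∈? : ∀ {k} (x : Fin k) (S : Subset k) → does (x ∈? S) ≡ lookup S x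
does-∈? zero    (true  ∷ S) = refl
does-∈? zero    (false ∷ S) = refl
does-∈? (suc x) (_ ∷ S)       = does-∈? x S

ι-sub : ∀ x y → ι (x ℤ.- y) ≡ ι x ℚ.- ι y
ι-sub x y = trans (ι-+ x (ℤ.- y)) (cong (ι x ℚ.+_) (ι-neg y))

ι-⟦⟧ : ∀ b → ι ⟦ b ⟧ ≡ ⟦ b ⟧ℚ
ι-⟦⟧ true  = refl
ι-⟦⟧ false = refl

seq-if : ∀ b x k → seq (if b then x else 0ℝ) k ≡ ⟦ b ⟧ℚ ℚ.* seq x k
seq-if true  x k = sym (ℚ.*-identityˡ (seq x k))
seq-if false x k = sym (ℚ.*-zeroˡ (seq x k))

module _ {m : ℕ} where

  lin : (Fin m → ℤ) → (Fin m → ℝ) → ℝ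
  lin c g = sumℝ λ a → c a · g a

  -- The bridge by which identities between linear forms are reduced to identities in `ℚ` at each
  -- index.
  seq-lin : ∀ c g k → seq (lin c g) k ≡ sumℚ λ a → ι (c a) ℚ.* seq (g a) k
  seq-lin c g k = trans (seq-sumℝ (λ a → c a · g a) k) (Sumℚ.sum-cong-≗ λ a → seq-· (c a) (g a) k)

  lin-fromℤ : ∀ c {f : Fin m → ℝ} {F} → (∀ a → f a ≃ fromℤ (F a)) →
    lin c f ≃ fromℤ (sumℤ λ a → c a ℤ.* F a)
  lin-fromℤ c {f} {F} f≃F = begin-equality
    lin c f                             ≈⟨ sumℝ-cong (λ a → ·-cong (c a) {f a} {fromℤ (F a)} (f≃F a)) ⟩
    lin c (fromℤ ∘ F)                   ≈⟨ ≃-pointwise {lin c (fromℤ ∘ F)} {fromℤ (sumℤ λ a → c a ℤ.* F a)} (λ k →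
      trans (seq-lin c (fromℤ ∘ F) k) (trans (Sumℚ.sum-cong-≗ λ a → sym (ι-* (c a) (F a)))
        (sym (ι-sum λ a → c a ℤ.* F a)))) ⟩
    fromℤ (sumℤ λ a → c a ℤ.* F a)      ∎
    where open ≤ℝ-Reasoning

  seq-Σℝ[] : ∀ (S : Subset m) (b : Fin m → Bool) → (∀ a → lookup S a ≡ b a) → ∀ g k →
    seq (Σℝ[ S ] g) k ≡ sumℚ λ a → ⟦ b a ⟧ℚ ℚ.* seq (g a) k
  seq-Σℝ[] S b eq g k = trans (seq-sumℝ (λ a → if does (a ∈? S) then g a else 0ℝ) k)
    (Sumℚ.sum-cong-≗ λ a → trans (cong (λ i → seq (if i then g a else 0ℝ) k) (trans (does-∈? a S) (eq a)))
      (seq-if (b a) (g a) k))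

  pos-sumℕ : ∀ {k} (h : Fin k → ℕ) → + sumℕ h ≡ sumℤ λ a → + h a
  pos-sumℕ {zero}  h = refl
  pos-sumℕ {suc k} h = cong (ℤ._+_ (+ h zero)) (pos-sumℕ (h ∘ suc))

  pos-Σℕ[] : ∀ (S : Subset m) (b : Fin m → Bool) → (∀ a → lookup S a ≡ b a) → ∀ h →
    + Σℕ[ S ] h ≡ sumℤ λ a → ⟦ b a ⟧ ℤ.* + h a
  pos-Σℕ[] S b eq h = trans (pos-sumℕ λ a → if does (a ∈? S) then h a else 0)
    (Sumℤ.sum-cong-≗ λ a → trans (cong (λ i → + (if i then h a else 0)) (trans (does-∈? a S) (eq a)))
      (if-pos (b a) (h a)))
    where
    if-pos : ∀ i x → + (if i then x else 0) ≡ ⟦ i ⟧ ℤ.* + x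
    if-pos true  x = sym (ℤ.*-identityˡ (+ x))
    if-pos false x = refl

∣⇒even : ∀ {k} → 2 ∣ k → Even (+ k)
∣⇒even {k} (divides q eq) = + q , trans (cong +_ (trans eq (ℕ.*-comm q 2))) (ℤ.pos-* 2 q)

even⇒∣ : ∀ {k} → Even (+ k) → 2 ∣ k
even⇒∣ {k} (j , eq) = divides ℤ.∣ j ∣ (trans (cong ℤ.∣_∣ eq) (trans (ℤ.abs-* (+ 2) j) (ℕ.*-comm 2 ℤ.∣ j ∣)))

-- Passage between real and integer flows

module RealFlow {n m} (N : SkewSymmetricNetwork n m) where
  open SkewSymmetricNetwork N
  open Integral N
  open ≤ℝ-Reasoning

  seq-netOutflow : ∀ g v k → seq (netOutflow N g v) k ≡ Sumℚ.net tail head (λ a → seq (g a) k) v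
  seq-netOutflow g v k = cong₂ ℚ._-_
    (seq-Σℝ[] (leaving v) (λ a → does (tail a ≟ v)) (lookup∘tabulate _) g k)
    (seq-Σℝ[] (entering v) (λ a → does (head a ≟ v)) (lookup∘tabulate _) g k)

  Σℝ[]-cong : ∀ (S : Subset m) {f g : Fin m → ℝ} → (∀ a → f a ≃ g a) → Σℝ[ S ] f ≃ Σℝ[ S ] g
  Σℝ[]-cong S {f} {g} h = sumℝ-cong λ a → go a (does (a ∈? S))
    where
    go : ∀ a b → (if b then f a else 0ℝ) ≃ (if b then g a else 0ℝ)
    go a true  = h a
    go a false = ≃-pointwise {0ℝ} {0ℝ} λ _ → refl

  netOutflow-cong : ∀ {f g : Fin m → ℝ} → (∀ a → f a ≃ g a) → ∀ v → netOutflow N f v ≃ netOutflow N g v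
  netOutflow-cong {f} {g} h v = ≤ℝ-antisym {netOutflow N f v} {netOutflow N g v}
    (mono {f} {g} h) (mono {g} {f} λ a → ≃-sym {f a} {g a} (h a))
    where
    mono : ∀ {f g : Fin m → ℝ} → (∀ a → f a ≃ g a) → netOutflow N f v ≤ℝ netOutflow N g v
    mono {f} {g} h = +ℝ-mono-≤ {Σℝ[ leaving v ] f} {Σℝ[ leaving v ] g} { -ℝ Σℝ[ entering v ] f} { -ℝ Σℝ[ entering v ] g}
      (≃⇒≤ {Σℝ[ leaving v ] f} {Σℝ[ leaving v ] g} (Σℝ[]-cong (leaving v) h))
      (-ℝ-antimono-≤ {Σℝ[ entering v ] g} {Σℝ[ entering v ] f}
        (≃⇒≥ {Σℝ[ entering v ] f} {Σℝ[ entering v ] g} (Σℝ[]-cong (entering v) h)))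

  netOutflow-fromℤ : ∀ {f : Fin m → ℝ} {F} → (∀ a → f a ≃ fromℤ (F a)) → ∀ v →
    netOutflow N f v ≃ fromℤ (netF F v)
  netOutflow-fromℤ {f} {F} f≃F v = begin-equality
    netOutflow N f v            ≈⟨ netOutflow-cong {f} {fromℤ ∘ F} f≃F v ⟩
    netOutflow N (fromℤ ∘ F) v  ≈⟨ ≃-pointwise {netOutflow N (fromℤ ∘ F) v} {fromℤ (netF F v)} (λ k →
      trans (seq-netOutflow (fromℤ ∘ F) v k) (sym (trans (ι-sub (sumℤ λ a → ⟦ does (tail a ≟ v) ⟧ ℤ.* F a) (sumℤ λ a → ⟦ does (head a ≟ v) ⟧ ℤ.* F a)) (cong₂ ℚ._-_ (part tail) (part head))))) ⟩
    fromℤ (netF F v)            ∎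
    where
    part : ∀ (end : Fin m → Fin n) → ι (sumℤ λ a → ⟦ does (end a ≟ v) ⟧ ℤ.* F a) ≡
      sumℚ (λ a → ⟦ does (end a ≟ v) ⟧ℚ ℚ.* ι (F a))
    part end = trans (ι-sum λ a → ⟦ does (end a ≟ v) ⟧ ℤ.* F a)
      (Sumℚ.sum-cong-≗ λ a → trans (ι-* ⟦ does (end a ≟ v) ⟧ (F a)) (cong (ℚ._* ι (F a)) (ι-⟦⟧ (does (end a ≟ v)))))

  fromℤ-injective : ∀ {x y} → fromℤ x ≃ fromℤ y → x ≡ y
  fromℤ-injective {x} {y} h = ℤ.≤-antisym
    (fromℤ-cancel-≤ (≃⇒≤ {fromℤ x} {fromℤ y} h)) (fromℤ-cancel-≤ (≃⇒≥ {fromℤ x} {fromℤ y} h))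

  fromℤ-isISFlow : ∀ {G} → IsISFlowℤ G → IsISFlow N (fromℤ ∘ G)
  fromℤ-isISFlow {G} flow = record
    { isFlow = record
      { nonNegative  = λ a → fromℤ-mono-≤ (nonNegative a)
      ; capacity     = λ a → fromℤ-mono-≤ (capacity a)
      ; conservation = λ v v≢s v≢s′ → subst (λ z → netOutflow N (fromℤ ∘ G) v ≃ fromℤ z)
          (conservation v v≢s v≢s′) (netOutflow-fromℤ {fromℤ ∘ G} {G} (λ a → ≃-refl (fromℤ (G a))) v)
      }
    ; integral  = λ a → G a , ≃-refl (fromℤ (G a))
    ; symmetric = λ a → subst (λ z → fromℤ z ≃ fromℤ (G a)) (sym (symmetric a)) (≃-refl (fromℤ (G a)))
    }
    where
    open IsISFlowℤ flow
    ≃-refl : ∀ x → x ≃ x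
    ≃-refl x = ≃-pointwise {x} {x} λ _ → refl

  module _ {f : Fin m → ℝ} (isf : IsISFlow N f) where
    private
      module IS = IsISFlow isf
      module Fl = IsFlow IS.isFlow

    rounding : Fin m → ℤ
    rounding a = proj₁ (IS.integral a)

    rounding-≃ : ∀ a → f a ≃ fromℤ (rounding a)
    rounding-≃ a = proj₂ (IS.integral a)

    rounding-isISFlow : IsISFlowℤ rounding
    rounding-isISFlow = record
      { nonNegative = λ a → fromℤ-cancel-≤ {0ℤ} {rounding a} (begin
          0ℝ                  ≲⟨ Fl.nonNegative a ⟩
          f a                 ≈⟨ rounding-≃ a ⟩
          fromℤ (rounding a)  ∎)
      ; capacity = λ a → fromℤ-cancel-≤ {rounding a} {+ u a} (begin
          fromℤ (rounding a)  ≈⟨ rounding-≃ a ⟨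
          f a                 ≲⟨ Fl.capacity a ⟩
          fromℤ (+ u a)       ∎)
      ; conservation = λ v v≢s v≢s′ → fromℤ-injective {netF rounding v} {0ℤ} (begin-equality
          fromℤ (netF rounding v) ≈⟨ netOutflow-fromℤ {f} {rounding} rounding-≃ v ⟨
          netOutflow N f v        ≈⟨ Fl.conservation v v≢s v≢s′ ⟩
          0ℝ                      ∎)
      ; symmetric = λ a → fromℤ-injective {rounding (σE a)} {rounding a} (begin-equality
          fromℤ (rounding (σE a)) ≈⟨ rounding-≃ (σE a) ⟨
          f (σE a)                ≈⟨ IS.symmetric a ⟩
          f a                     ≈⟨ rounding-≃ a ⟩
          fromℤ (rounding a)      ∎)
      }

∉⇒lookup : ∀ {k} {x : Fin k} {S : Subset k} → x ∉ₛ S → lookup S x ≡ false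
∉⇒lookup {x = x} {S} x∉ = go (lookup S x) refl
  where
  go : ∀ b → lookup S x ≡ b → b ≡ false
  go false _  = refl
  go true  eq = ⊥-elim (x∉ (lookup⇒[]= x S eq))

lookup⇒∉ : ∀ {k} {x : Fin k} {S : Subset k} → lookup S x ≡ false → x ∉ₛ S
lookup⇒∉ {x = x} {S} eq x∈ with () ← trans (sym eq) ([]=⇒lookup x∈)

-- Odd fragments and their characteristic functions

module OddFragments {n m} (N : SkewSymmetricNetwork n m) where
  open SkewSymmetricNetwork N
  open Integral N

  -- Pointwise agreement with the subsets covers both an arbitrary fragment, read by `lookup`, and a
  -- component, given by `tabulate`.
  module _ (ρ : OddFragment N) (x : Fin n → Bool) (U : Fin m → Bool)
    (nodes≗ : ∀ v → lookup (OddFragment.nodes ρ) v ≡ x v)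
    (arcs≗ : ∀ a → lookup (OddFragment.arcs ρ) a ≡ U a) where
    open OddFragment ρ

    x-σ : ∀ v → x (σV v) ≡ x v
    x-σ v = trans (sym (nodes≗ (σV v))) (trans (sym (lookup∘tabulate (λ w → lookup nodes (σV w)) v))
      (trans (cong (λ S → lookup S v) selfSymmetric) (nodes≗ v)))

    s∉x : x s ≡ false
    s∉x = trans (sym (nodes≗ s)) (∉⇒lookup source∉)

    U-enters : ∀ a → U a ≡ true → x (head a) ≡ true × x (tail a) ≡ false
    U-enters a eq with arcsEnter a (lookup⇒[]= a arcs (trans (arcs≗ a) eq))
    ... | t∉ , h∈ = trans (sym (nodes≗ (head a))) ([]=⇒lookup h∈) , trans (sym (nodes≗ (tail a))) (∉⇒lookup t∉)

    -- An arc leaving the self-symmetric node set is the mate of an entering one, so the mate's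
    -- share in `χ±` accounts for leaving arcs.
    χ-χ± : ∀ F (flow : IsISFlowℤ F) a → χ N ρ a ≡ Fragment.χ± F flow x x-σ s∉x U a
    χ-χ± F flow a = trans (cong₂ (λ i j → if i then 1ℤ else if j then -1ℤ else 0ℤ)
        (trans (does-∈? a (arcs ∪ σ[ arcs ]E)) (trans (lookup-zipWith _∨_ a arcs σ[ arcs ]E)
          (cong₂ _∨_ (arcs≗ a) (trans (lookup∘tabulate (λ b → lookup arcs (σE b)) a) (arcs≗ (σE a))))))
        (trans (does-∈? a (δ nodes)) (trans (lookup∘tabulate (λ b → lookup nodes (tail b) xor lookup nodes (head b)) a)
          (cong₂ _xor_ (nodes≗ (tail a)) (nodes≗ (head a))))))
      (cases (U a) (U (σE a)) (x (tail a)) (x (head a)) (x (tail (σE a))) (x (head (σE a)))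
        (U-enters a) (U-enters (σE a))
        (trans (cong x (tail-σE a)) (x-σ (head a))) (trans (cong x (head-σE a)) (x-σ (tail a))))
      where
      cases : ∀ i j t h t′ h′ → (i ≡ true → h ≡ true × t ≡ false) → (j ≡ true → h′ ≡ true × t′ ≡ false) →
        t′ ≡ h → h′ ≡ t →
        (if i ∨ j then 1ℤ else if t xor h then -1ℤ else 0ℤ) ≡
        (+ 2 ℤ.* ⟦ i ⟧ ℤ.- ⟦ h ⟧ ℤ.* (1ℤ ℤ.- ⟦ t ⟧)) ℤ.+ (+ 2 ℤ.* ⟦ j ⟧ ℤ.- ⟦ h′ ⟧ ℤ.* (1ℤ ℤ.- ⟦ t′ ⟧))
      -- Impossible: an arc and its mate cannot both enter a self-symmetric set.
      cases true  true  t     h     _ _ p q refl refl with p refl | q refl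
      ... | refl , refl | () , _
      cases true  false t     h     _ _ p q refl refl with p refl
      ... | refl , refl = refl
      cases false true  t     h     _ _ p q refl refl with q refl
      ... | refl , refl = refl
      cases false false true  true  _ _ p q refl refl = refl
      cases false false true  false _ _ p q refl refl = refl
      cases false false false true  _ _ p q refl refl = refl
      cases false false false false _ _ p q refl refl = refl

    Σ-arcs : + Σℕ[ arcs ] u ≡ sumℤ λ a → ⟦ U a ⟧ ℤ.* + u a
    Σ-arcs = pos-Σℕ[] arcs U arcs≗ u

  fragment-valid : ∀ {f : Fin m → ℝ} {F} → (∀ a → f a ≃ fromℤ (F a)) → IsISFlowℤ F → ∀ ρ →
    lin (χ N ρ) f ≤ℝ fromℤ (+ 2 ℤ.* + Σℕ[ OddFragment.arcs ρ ] u ℤ.- + 2)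
  fragment-valid {f} {F} f≃F flow ρ = begin
    lin (χ N ρ) f                             ≈⟨ lin-fromℤ (χ N ρ) {f} {F} f≃F ⟩
    fromℤ (sumℤ λ a → χ N ρ a ℤ.* F a)        ≲⟨ fromℤ-mono-≤ bound ⟩
    fromℤ (+ 2 ℤ.* + Σℕ[ arcs ] u ℤ.- + 2)    ∎
    where
    open OddFragment ρ
    open ≤ℝ-Reasoning
    x = lookup nodes
    U = lookup arcs
    eqx : ∀ v → lookup nodes v ≡ x v
    eqx _ = refl
    eqU : ∀ a → lookup arcs a ≡ U a
    eqU _ = refl
    open Fragment F flow x (x-σ ρ x U eqx eqU) (s∉x ρ x U eqx eqU)
    bound : sumℤ (λ a → χ N ρ a ℤ.* F a) ℤ.≤ + 2 ℤ.* + Σℕ[ arcs ] u ℤ.- + 2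
    bound = subst₂ ℤ._≤_
      (Sumℤ.sum-cong-≗ λ a → cong (ℤ._* F a) (sym (χ-χ± ρ x U eqx eqU F flow a)))
      (cong (λ z → + 2 ℤ.* z ℤ.- + 2) (sym (Σ-arcs ρ x U eqx eqU)))
      (fragment-bound U (U-enters ρ x U eqx eqU) λ even → odd (even⇒∣ (subst Even (sym (Σ-arcs ρ x U eqx eqU)) even)))

module Potential {n m} (N : SkewSymmetricNetwork n m) (g : Fin m → ℝ)
  (conservation : ∀ v → v ≢ SkewSymmetricNetwork.s N → v ≢ SkewSymmetricNetwork.s′ N → netOutflow N g v ≃ 0ℝ) where
  open SkewSymmetricNetwork N
  open RealFlow N
  open ≤ℝ-Reasoning

  -- After summation by parts only the term of `s` survives: conservation removes the other nodes,
  -- and the zero potential removes `s′`, where conservation is not imposed.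
  lin-potential : ∀ (k : Fin n → ℤ) → k s ≡ + 2 → k s′ ≡ 0ℤ →
    lin (λ a → k (tail a) ℤ.- k (head a)) g ≃ (+ 2) · value N g
  lin-potential k ks ks′ = begin-equality
    lin (λ a → k (tail a) ℤ.- k (head a)) g  ≈⟨ ≃-pointwise {lin (λ a → k (tail a) ℤ.- k (head a)) g} {sumℝ λ v → k v · netOutflow N g v} regroup ⟩
    sumℝ (λ v → k v · netOutflow N g v)      ≈⟨ sumℝ-cong term ⟩
    sumℝ source-term                         ≈⟨ ≃-pointwise {sumℝ source-term} {(+ 2) · value N g} select ⟩
    (+ 2) · value N g                        ∎
    where
    source-term : Fin n → ℝ
    source-term v = if does (s ≟ v) then (+ 2) · netOutflow N g v else 0ℝ

    regroup : ∀ j → seq (lin (λ a → k (tail a) ℤ.- k (head a)) g) j ≡ seq (sumℝ λ v → k v · netOutflow N g v) j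
    regroup j = trans (seq-lin (λ a → k (tail a) ℤ.- k (head a)) g j)
      (trans (Sumℚ.sum-cong-≗ λ a → cong (ℚ._* seq (g a) j) (ι-sub (k (tail a)) (k (head a))))
      (trans (sym (Sumℚ.sum-potential tail head (λ v → ι (k v)) (λ a → seq (g a) j)))
      (trans (Sumℚ.sum-cong-≗ λ v → trans (cong (ι (k v) ℚ.*_) (sym (seq-netOutflow g v j)))
                                      (sym (seq-· (k v) (netOutflow N g v) j)))
        (sym (seq-sumℝ (λ v → k v · netOutflow N g v) j)))))

    select : ∀ j → seq (sumℝ source-term) j ≡ seq ((+ 2) · value N g) j
    select j = trans (seq-sumℝ source-term j)
      (trans (Sumℚ.sum-cong-≗ λ v → seq-if (does (s ≟ v)) ((+ 2) · netOutflow N g v) j)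
        (Sumℚ.sum-select s (λ v → seq ((+ 2) · netOutflow N g v) j)))

    ·-zero : ∀ z → z · 0ℝ ≃ 0ℝ
    ·-zero z = ≃-pointwise {z · 0ℝ} {0ℝ} λ j → trans (seq-· z 0ℝ j) (ℚ.*-zeroʳ (ι z))

    term : ∀ v → k v · netOutflow N g v ≃ source-term v
    term v = go (s ≟ v) (v ≟ s′)
      where
      go : (d : Dec (s ≡ v)) → Dec (v ≡ s′) →
        k v · netOutflow N g v ≃ (if does d then (+ 2) · netOutflow N g v else 0ℝ)
      go (yes refl) _ = subst (λ z → k s · netOutflow N g s ≃ z · netOutflow N g s) ks
        (≃-pointwise {k s · netOutflow N g s} {k s · netOutflow N g s} λ _ → refl)
      go (no _) (yes refl) = subst (λ z → z · netOutflow N g s′ ≃ 0ℝ) (sym ks′) (≃-pointwise {0ℝ} {0ℝ} λ _ → refl)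
      go (no s≢v) (no v≢s′) = begin-equality
        k v · netOutflow N g v  ≈⟨ ·-cong (k v) {netOutflow N g v} {0ℝ} (conservation v (s≢v ∘ sym) v≢s′) ⟩
        k v · 0ℝ                ≈⟨ ·-zero (k v) ⟩
        0ℝ                      ∎

lin-split : ∀ {m l} (κ c : Fin m → ℤ) (w : Fin l → Fin m → ℤ) → (∀ a → κ a ≡ c a ℤ.+ sumℤ (λ x → w x a)) →
  ∀ g → lin κ g ≃ lin c g +ℝ sumℝ (λ x → lin (w x) g)
lin-split κ c w split g = ≃-pointwise {lin κ g} {lin c g +ℝ sumℝ (λ x → lin (w x) g)} λ j →
  let q = λ a → seq (g a) j in
  trans (seq-lin κ g j)
  (trans (Sumℚ.sum-cong-≗ λ a → trans
      (cong (ℚ._* q a) (trans (cong ι (split a)) (trans (ι-+ (c a) (sumℤ λ x → w x a))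
        (cong (ι (c a) ℚ.+_) (ι-sum λ x → w x a)))))
      (trans (ℚ.*-distribʳ-+ (q a) (ι (c a)) (sumℚ λ x → ι (w x a)))
        (cong (ι (c a) ℚ.* q a ℚ.+_) (Sumℚ.*-distribʳ-sum (q a) (λ x → ι (w x a))))))
  (trans (Sumℚ.∑-distrib-+ (λ a → ι (c a) ℚ.* q a) (λ a → sumℚ λ x → ι (w x a) ℚ.* q a))
  (cong₂ ℚ._+_ (sym (seq-lin c g j))
    (trans (Sumℚ.∑-comm (λ a x → ι (w x a) ℚ.* q a))
      (sym (trans (seq-sumℝ (λ x → lin (w x) g) j) (Sumℚ.sum-cong-≗ λ x → seq-lin (w x) g j)))))))

-- Optimality by complementary slackness

module Duality {n m} (N : SkewSymmetricNetwork n m) (noArcEnters : NoArcEntersSource N)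
  {f : Fin m → ℝ} {F : Fin m → ℤ} (f≃F : ∀ a → f a ≃ fromℤ (F a)) (flow : Integral.IsISFlowℤ N F)
  (f-conservation : ∀ v → v ≢ SkewSymmetricNetwork.s N → v ≢ SkewSymmetricNetwork.s′ N → netOutflow N f v ≃ 0ℝ)
  where
  open SkewSymmetricNetwork N
  open Integral N
  open RealFlow N
  open OddFragments N
  open Residual N F flow
  open Barrier N F flow
  open Dual N F flow
  open ≤ℝ-Reasoning

  objective-value : ∀ g → objective N g ≃ value N g
  objective-value g = ≃-pointwise {objective N g} {value N g} λ j → sym (trans
    (cong (λ q → seq (objective N g) j ℚ.- q) (trans
      (seq-Σℝ[] (entering s) (λ _ → false)
        (λ a → trans (lookup∘tabulate (λ b → does (head b ≟ s)) a) (dec-false (head a ≟ s) (noArcEnters a))) g j)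
      (trans (Sumℚ.sum-cong-≗ λ a → ℚ.*-zeroˡ (seq (g a) j)) (Sumℚ.sum-replicate-zero m))))
    (ℚ.+-identityʳ (seq (objective N g) j)))

  module _ (label : Fin n → Class) (hasClass : ∀ v → HasClass v (label v)) (s-near : label s ≡ near)
    {g : Fin m → ℝ} (feasible : IsFeasible N g) where
    open IsFeasible feasible
    open Labelled label hasClass
    open Weights label hasClass s-near

    k : Fin n → ℤ
    k v = level (label v)

    -- An identity shared by `g` and `f`, so their objectives can be compared term by term.
    decompose : ∀ h → (∀ v → v ≢ s → v ≢ s′ → netOutflow N h v ≃ 0ℝ) →
      (+ 2) · objective N h ≃ lin cost h +ℝ sumℝ (λ x → lin (weight x) h)
    decompose h cons = begin-equality
      (+ 2) · objective N h                      ≈⟨ ·-cong (+ 2) {objective N h} {value N h} (objective-value h) ⟩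
      (+ 2) · value N h                          ≈⟨ Potential.lin-potential N h cons k (cong level s-near)
                                                      (cong level (trans (label-σ s) (cong opposite s-near))) ⟨
      lin (λ a → k (tail a) ℤ.- k (head a)) h    ≈⟨ lin-split (λ a → k (tail a) ℤ.- k (head a)) cost weight cost+weights h ⟩
      lin cost h +ℝ sumℝ (λ x → lin (weight x) h) ∎

    cost-term : ∀ a → cost a · g a ≤ℝ cost a · f a
    cost-term a = go (cost a) (cost-slackness a)
      where
      go : ∀ c → c ≡ 0ℤ ⊎ (0ℤ ℤ.≤ c × F a ≡ + u a) ⊎ (c ℤ.≤ 0ℤ × F a ≡ 0ℤ) → c · g a ≤ℝ c · f a
      go _ (inj₁ refl) = ≤ℝ-refl {0ℝ}
      go c (inj₂ (inj₁ (0≤c , F≡u))) = ·-monoʳ-≤-nonNeg {c} {g a} {f a} 0≤c (begin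
        g a              ≲⟨ capacity a ⟩
        fromℤ (+ u a)    ≡⟨ cong fromℤ F≡u ⟨
        fromℤ (F a)      ≈⟨ f≃F a ⟨
        f a              ∎)
      go c (inj₂ (inj₂ (c≤0 , F≡0))) = ·-monoʳ-≤-nonPos {c} {g a} {f a} c≤0 (begin
        f a              ≈⟨ f≃F a ⟩
        fromℤ (F a)      ≡⟨ cong fromℤ F≡0 ⟩
        0ℝ               ≲⟨ nonNegative a ⟩
        g a              ∎)

    module _ (x : Fin n) (v : Fin n) (v∈x : label v ≡ comp x) where
      open Component s-near x

      fragment : OddFragment N
      fragment = record
        { nodes         = tabulate (nodesOf x)
        ; arcs          = tabulate (arcsOf x)
        ; selfSymmetric = tabulate-cong λ w → trans (lookup∘tabulate (nodesOf x) (σV w)) (nodesOf-σ x w)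
        ; source∉       = lookup⇒∉ (trans (lookup∘tabulate (nodesOf x) s) (cong (λ p → is p x) s-near))
        ; arcsEnter     = λ a a∈ → enters a (trans (sym (lookup∘tabulate (arcsOf x) a)) ([]=⇒lookup a∈))
        ; odd           = λ 2∣ → tight-odd (arcsOf x) (slack≡1 v v∈x)
            (subst Even (pos-Σℕ[] (tabulate (arcsOf x)) (arcsOf x) (lookup∘tabulate (arcsOf x)) u) (∣⇒even 2∣))
        }
        where
        enters : ∀ a → arcsOf x a ≡ true → tail a ∉ₛ tabulate (nodesOf x) × head a ∈ₛ tabulate (nodesOf x)
        enters a eq = split (label (tail a)) refl eq
          where
          split : ∀ p → label (tail a) ≡ p → isNear p ∧ is (label (head a)) x ≡ true →
            tail a ∉ₛ tabulate (nodesOf x) × head a ∈ₛ tabulate (nodesOf x)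
          split near e eq =
            lookup⇒∉ (trans (lookup∘tabulate (nodesOf x) (tail a)) (cong (λ p → is p x) e)) ,
            lookup⇒[]= (head a) _ (trans (lookup∘tabulate (nodesOf x) (head a)) eq)

      weight-term : lin (weight x) g ≤ℝ lin (weight x) f
      weight-term = begin
        lin (weight x) g                ≈⟨ ≃-pointwise {lin (weight x) g} {lin (χ N fragment) g} (λ j →
                                             trans (seq-lin (weight x) g j) (trans
                                               (Sumℚ.sum-cong-≗ λ a → cong (λ z → ι z ℚ.* seq (g a) j) (sym (χ-weight a)))
                                               (sym (seq-lin (χ N fragment) g j)))) ⟩
        lin (χ N fragment) g            ≲⟨ oddFragment fragment ⟩
        fromℤ (+ 2 ℤ.* + Σℕ[ tabulate (arcsOf x) ] u ℤ.- + 2)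
          ≡⟨ cong fromℤ (trans (cong (λ z → + 2 ℤ.* z ℤ.- + 2)
               (pos-Σℕ[] (tabulate (arcsOf x)) (arcsOf x) (lookup∘tabulate (arcsOf x)) u))
               (sym (tight (arcsOf x) (slack≡1 v v∈x)))) ⟩
        fromℤ (sumℤ λ a → weight x a ℤ.* F a) ≈⟨ lin-fromℤ (weight x) {f} {F} f≃F ⟨
        lin (weight x) f                ∎
        where
        χ-weight : ∀ a → χ N fragment a ≡ weight x a
        χ-weight = χ-χ± fragment (nodesOf x) (arcsOf x)
          (lookup∘tabulate (nodesOf x)) (lookup∘tabulate (arcsOf x)) F flow

    weight-≤ : ∀ x → lin (weight x) g ≤ℝ lin (weight x) f
    weight-≤ x = go (any? λ v → is (label v) x Bool.≟ true)
      where
      go : Dec (∃[ v ] is (label v) x ≡ true) → lin (weight x) g ≤ℝ lin (weight x) f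
      go (yes (v , v∈x)) = weight-term x v (is⇒≡ (label v) v∈x)
      go (no ∉x) = ≤ℝ-pointwise {lin (weight x) g} {lin (weight x) f} λ j → ℚ.≤-reflexive
        (trans (vanish g j) (sym (vanish f j)))
        where
        vanish : ∀ h j → seq (lin (weight x) h) j ≡ 0ℚ
        vanish h j = trans (seq-lin (weight x) h j) (trans
          (Sumℚ.sum-cong-≗ λ a → trans (cong (λ z → ι z ℚ.* seq (h a) j)
            (weight-empty x (λ v v∈x → ∉x (v , trans (cong (λ p → is p x) v∈x) (is-comp x))) a)) (ℚ.*-zeroˡ (seq (h a) j)))
          (Sumℚ.sum-replicate-zero m))

    objective-≤ : objective N g ≤ℝ objective N f
    objective-≤ = 2·-cancel-≤ {objective N g} {objective N f} (begin
      (+ 2) · objective N g                        ≈⟨ decompose g conservation ⟩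
      lin cost g +ℝ sumℝ (λ x → lin (weight x) g)  ≲⟨ +ℝ-mono-≤ {lin cost g} {lin cost f} {sumℝ (λ x → lin (weight x) g)} {sumℝ (λ x → lin (weight x) f)}
                                                        (sumℝ-mono-≤ cost-term) (sumℝ-mono-≤ weight-≤) ⟩
      lin cost f +ℝ sumℝ (λ x → lin (weight x) f)  ≈⟨ decompose f f-conservation ⟨
      (+ 2) · objective N f                        ∎)

  objective-bound : ¬ Reachable s′ → ∀ {g} → IsFeasible N g → objective N g ≤ℝ objective N f
  objective-bound ¬s′ {g} feasible = ≤ℝ-stable {objective N g} {objective N f} (¬¬-map
    (λ class → let hasClass = λ v → proj₂ (class v) in
      objective-≤ (λ v → proj₁ (class v)) hasClass
        -- The empty trail reaches `s`, and `s′` is unreachable, so `s` is outer.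
        (hasClass-unique (hasClass s) (near (([] , refl , []) , ¬s′))) feasible)
    -- As there are finitely many nodes, their double negations combine into a single one.
    (sequence (RawMonad.rawApplicative ¬¬-Monad) classify))

mainTheorem7 : ∀ {n m : ℕ} (N : SkewSymmetricNetwork n m) → NoArcEntersSource N →
    ∀ (f : Fin m → ℝ) → IsMaximumISFlow N f →
    IsOptimalSolution N f × IsOptimumValue N (value N f)
mainTheorem7 N noArcEnters f (isf , maximum) = optimal , f , optimal , objective-value f
  where
  open SkewSymmetricNetwork N using (s; s′)
  open Integral N
  open RealFlow N
  open IsISFlow isf using (isFlow)
  F = rounding isf
  flow = rounding-isISFlow isf
  f≃F = rounding-≃ isf
  open Residual N F flow using (Reachable; module Augment)
  open Duality N noArcEnters {f} {F} f≃F flow (IsFlow.conservation isFlow) using (objective-value; objective-bound)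

  value-≤ : ∀ {G} → IsISFlowℤ G → netF G s ℤ.≤ netF F s
  value-≤ {G} G-flow = fromℤ-cancel-≤ {netF G s} {netF F s} (begin
    fromℤ (netF G s)           ≈⟨ netOutflow-fromℤ {fromℤ ∘ G} {G} (λ a → ≃-pointwise {fromℤ (G a)} {fromℤ (G a)} λ _ → refl) s ⟨
    value N (fromℤ ∘ G)        ≲⟨ maximum (fromℤ ∘ G) (fromℤ-isISFlow G-flow) ⟩
    value N f                  ≈⟨ netOutflow-fromℤ {f} {F} f≃F s ⟩
    fromℤ (netF F s)           ∎)
    where open ≤ℝ-Reasoning

  unreachable : ¬ Reachable s′
  unreachable (es , trail) = ℤ.<⇒≱ (Augment.F⁺-value es trail) (value-≤ (Augment.F⁺-isISFlow es trail))

  optimal : IsOptimalSolution N f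
  optimal = record
    { nonNegative  = IsFlow.nonNegative isFlow
    ; capacity     = IsFlow.capacity isFlow
    ; conservation = IsFlow.conservation isFlow
    ; oddFragment  = OddFragments.fragment-valid N {f} {F} f≃F flow
    } , λ g feasible → objective-bound unreachable feasible
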